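{- For every $k\geq3$, $$G_{21\mbox{ - }3\mbox{ - }\cdots\mbox{ - }k}(x)=\frac{1}{U_k^2\left(\frac{1}{2\sqrt{x}}\right)}.$$
   Context: A generalized pattern is a permutation of $\{1,\dots,k\}$ written as a word $\tau_1\cdots\tau_k$ in which each pair of adjacent letters may or may not be separated by a dash "-". An occurrence of $\tau$ in $\pi=\pi_1\cdots\pi_n\in S_n$ is a choice of indices $i_1<\dots<i_k$ with $(\pi_{i_1},\dots,\pi_{i_k})$ order-isomorphic to $(\tau_1,\dots,\tau_k)$ and $i_{j+1}=i_j+1$ whenever $\tau_j,\tau_{j+1}$ are not separated by a dash; $\pi$ avoids $\tau$ if there is no occurrence. $1\mbox{ - }3\mbox{ - }2$ is the classical pattern $132$. $G_\tau(x)=\sum_{n\geq0}g_\tau(n)x^n$ with $g_\tau(n)$ the number of permutations in $S_n$ avoiding $1\mbox{ - }3\mbox{ - }2$ and having exactly one occurrence of $\tau$. $U_p$ is the Chebyshev polynomial of the second kind, $U_p(\cos\theta)=\sin((p+1)\theta)/\sin\theta$. -}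

module Defs where

open import Data.Nat using (ℕ; zero; suc; _+_; _∸_; _<ᵇ_; _≡ᵇ_)
open import Data.Bool using (Bool; true; false; _∧_; if_then_else_; not)
open import Data.List using (List; []; _∷_; map; _++_; concatMap; length; filter; replicate; upTo)
open import Data.Product using (_×_; _,_; proj₁; proj₂)
open import Data.Integer as ℤ using (ℤ; +_)
open import Relation.Nullary.Decidable using (yes; no)
open import Relation.Binary.PropositionalEquality using (_≡_)
open import Data.Bool using (T)
open import Data.Bool.Properties using (T?)

inserts : ℕ → List ℕ → List (List ℕ)
inserts x []       = (x ∷ []) ∷ []
inserts x (y ∷ ys) = (x ∷ y ∷ ys) ∷ map (y ∷_) (inserts x ys)

S : ℕ → List (List ℕ)
S zero    = [] ∷ []
S (suc n) = concatMap (inserts (suc n)) (S n)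

-- A generalized pattern τ₁ ⋯ τₖ: the word τ (a permutation of {1..k})
-- and, for each of the k-1 adjacent pairs (τⱼ,τⱼ₊₁), a flag:
-- true = separated by a dash, false = must be adjacent in an occurrence.
record GPattern : Set where
  constructor gpat
  field
    word   : List ℕ
    dashes : List Bool
open GPattern public

indexed : ℕ → List ℕ → List (ℕ × ℕ)
indexed i []       = []
indexed i (x ∷ xs) = (i , x) ∷ indexed (suc i) xs

subseqs : {A : Set} → List A → List (List A)
subseqs []       = [] ∷ []
subseqs (x ∷ xs) = map (x ∷_) (subseqs xs) ++ subseqs xs

adjOK : List Bool → List (ℕ × ℕ) → Bool
adjOK (d ∷ ds) ((i , _) ∷ (j , v) ∷ rest) =
  (d ∨' (j ≡ᵇ suc i)) ∧ adjOK ds ((j , v) ∷ rest)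
  where
  _∨'_ : Bool → Bool → Bool
  true  ∨' _ = true
  false ∨' b = b
adjOK _ _ = true

sameLength : {A B : Set} → List A → List B → Bool
sameLength []       []       = true
sameLength (_ ∷ xs) (_ ∷ ys) = sameLength xs ys
sameLength _        _        = false

pairs : {A B : Set} → List A → List B → List (A × B)
pairs (x ∷ xs) (y ∷ ys) = (x , y) ∷ pairs xs ys
pairs _        _        = []

allB : {A : Set} → (A → Bool) → List A → Bool
allB p []       = true
allB p (x ∷ xs) = p x ∧ allB p xs

eqB : Bool → Bool → Bool
eqB true  b = b
eqB false b = not b

orderIso : List ℕ → List (ℕ × ℕ) → Bool
orderIso τ s =
  let ps = pairs τ (map proj₂ s) in
  allB (λ a → allB (λ b → eqB (proj₁ a <ᵇ proj₁ b) (proj₂ a <ᵇ proj₂ b)) ps) ps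

isOccurrence : GPattern → List (ℕ × ℕ) → Bool
isOccurrence p s =
  sameLength (word p) s ∧ adjOK (dashes p) s ∧ orderIso (word p) s

occurrences : GPattern → List ℕ → ℕ
occurrences p π =
  length (filter (λ s → T? (isOccurrence p s)) (subseqs (indexed 0 π)))

p1-3-2 : GPattern
p1-3-2 = gpat (1 ∷ 3 ∷ 2 ∷ []) (true ∷ true ∷ [])

from3 : ℕ → List ℕ
from3 k = map (λ i → i + 3) (upTo (k ∸ 2))

p21-3-k : ℕ → GPattern
p21-3-k k = gpat (2 ∷ 1 ∷ from3 k) (false ∷ replicate (k ∸ 2) true)

g : GPattern → ℕ → ℕ
g τ n = length (filter (λ π → T? ((occurrences p1-3-2 π ≡ᵇ 0) ∧ (occurrences τ π ≡ᵇ 1))) (S n))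

-- Integer polynomials as coefficient lists (constant term first)

Poly : Set
Poly = List ℤ

_⊕_ : Poly → Poly → Poly
[]       ⊕ q        = q
(a ∷ p)  ⊕ []       = a ∷ p
(a ∷ p)  ⊕ (b ∷ q)  = (a ℤ.+ b) ∷ (p ⊕ q)

scale : ℤ → Poly → Poly
scale c = map (c ℤ.*_)

_⊗_ : Poly → Poly → Poly
[]      ⊗ q = []
(a ∷ p) ⊗ q = scale a q ⊕ (+ 0 ∷ (p ⊗ q))

coeff : Poly → ℕ → ℤ
coeff []       _       = + 0
coeff (a ∷ p)  zero    = a
coeff (a ∷ p)  (suc n) = coeff p n

-- V p (x) = x^{p/2} · U_p(1/(2√x)), a polynomial in x.
-- From U₀ = 1, U₁(t) = 2t, U_{p+2}(t) = 2t U_{p+1}(t) - U_p(t) one gets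
-- V₀ = 1, V₁ = 1, V_{p+2} = V_{p+1} - x V_p.
V : ℕ → Poly
V zero          = + 1 ∷ []
V (suc zero)    = + 1 ∷ []
V (suc (suc p)) = V (suc p) ⊕ (+ 0 ∷ scale (ℤ.- (+ 1)) (V p))

convCoeff : (ℕ → ℤ) → Poly → ℕ → ℤ
convCoeff a q n = go n
  where
  go : ℕ → ℤ
  go zero    = a 0 ℤ.* coeff q n
  go (suc i) = a (suc i) ℤ.* coeff q (n ∸ suc i) ℤ.+ go i

{-# OPTIONS --safe #-}
module Submission where

-- Write a 132-avoiding permutation of length n + 1 as α x β with x its maximum.
-- Every letter of α exceeds every letter of β, and α and β avoid 132. Writing
-- τ k for 21-3-⋯-(k+2), an occurrence of τ (k+1) lies in α, or in β, or consists of an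
-- occurrence of τ k in α followed by x. Let F k count the 132-avoiding permutations
-- without τ k, and H k those with exactly one τ k and no τ (k+1); for k ≥ 1 an
-- occurrence of τ (k+1) contains two of τ k, so the last condition is void. Then
--   F (k+1) = 1 + x F k F (k+1),   H (k+1) = x (H k F (k+1) + F k H (k+1)),
-- while counting descents gives F 0 = 1 + x F 0 and H 0 = x F 0 (F 0 − 1). Hence
-- F k V (k+2) = V (k+1) and H k V (k+2)² = x^(k+2) by induction on k.
open import Defs
open import Data.Nat using (ℕ; _≤_; _≡ᵇ_)
open import Data.Integer using (ℤ; +_)
open import Data.Bool using (if_then_else_)
open import Relation.Binary.PropositionalEquality using (_≡_)
open import Algebra using (CommutativeRing)

-- The list `S (suc n)` comes from `S n` by inserting a new maximum, so it presents α x β through a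
-- cut of a word αβ of `S n`, not through two independent permutations. The obstacle is that the
-- cuts at which α dominates β must run exactly once through all pairs of a raised permutation and a
-- permutation of complementary size. No bijection is built: this is an equality of sums for
-- arbitrary weights of (α, β), proved by induction on n with each insertion absorbed into the
-- weight. The condition on τ (k+1) in H k is what closes the recurrence: x extends every τ (k+1)
-- inside α to a τ (k+2), so excluding τ (k+2) leaves α without τ (k+1), and the single τ (k+1) ends
-- in x or lies in β. The pattern 21 must start the induction by a separate argument: its first
-- letter exceeds its last, so an occurrence can pass from x to β. All equations are kept free of
-- subtraction and division, with the denominators V multiplied out.

-- Solving the recurrences in a commutative ring

module RationalRecurrences {c ℓ} (R : CommutativeRing c ℓ) where
  open CommutativeRing R
  open import Algebra.Properties.Ring ring using (+-cancelʳ)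
  open import Relation.Binary.Reasoning.Setoid setoid

  open import Algebra.Solver.Ring.NaturalCoefficients.Default commutativeSemiring
    using (solve; _:=_; _:+_; _:*_)

  -- With u = f v the first hypothesis says v′ = (1 - x f) v and the last one (1 - x f) f′ = r. Both
  -- sides are compared after adding x f f′ v.
  linear-fixpoint : ∀ {x u v v′ f f′ r} → v′ + x * u ≈ v → f * v ≈ u →
    f′ ≈ r + x * (f * f′) → f′ * v′ ≈ r * v
  linear-fixpoint {x} {u} {v} {v′} {f} {f′} {r} v≈ fv≈u f′≈ =
    +-cancelʳ (x * (f * f′) * v) _ _ (begin
      f′ * v′ + x * (f * f′) * v       ≈⟨ regroup f′ v′ x f v ⟩
      f′ * (v′ + x * (f * v))          ≈⟨ *-congˡ (+-congˡ (*-congˡ fv≈u)) ⟩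
      f′ * (v′ + x * u)                ≈⟨ *-congˡ v≈ ⟩
      f′ * v                           ≈⟨ *-congʳ f′≈ ⟩
      (r + x * (f * f′)) * v           ≈⟨ distribʳ v r _ ⟩
      r * v + x * (f * f′) * v         ∎)
    where
    regroup : ∀ f′ v′ x f v →
      f′ * v′ + x * (f * f′) * v ≈ f′ * (v′ + x * (f * v))
    regroup = solve 5 (λ f′ v′ x f v →
      f′ :* v′ :+ x :* (f :* f′) :* v := f′ :* (v′ :+ x :* (f :* v))) refl

  avoid-step : ∀ {x u v v′ f f′} → v′ + x * u ≈ v → f * v ≈ u →
    f′ ≈ 1# + x * (f * f′) → f′ * v′ ≈ v
  avoid-step v≈ fv≈u f′≈ = trans (linear-fixpoint v≈ fv≈u f′≈) (*-identityˡ _)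

  once-base : ∀ {x f e h v} → v + x ≈ 1# → f * v ≈ 1# → f ≈ e + 1# →
    h ≈ x * (f * e) → h * (v * v) ≈ x * x
  once-base {x} {f} {e} {h} {v} v≈ fv≈1 f≈ h≈ = begin
    h * (v * v)              ≈⟨ *-congʳ h≈ ⟩
    x * (f * e) * (v * v)    ≈⟨ regroup x f e v ⟩
    x * ((f * v) * (e * v))  ≈⟨ *-congˡ (*-cong fv≈1 ev≈x) ⟩
    x * (1# * x)             ≈⟨ *-congˡ (*-identityˡ x) ⟩
    x * x                    ∎
    where
    regroup : ∀ x f e v → x * (f * e) * (v * v) ≈ x * ((f * v) * (e * v))
    regroup = solve 4 (λ x f e v →
      x :* (f :* e) :* (v :* v) := x :* ((f :* v) :* (e :* v))) refl
    -- Since e = f - 1 and f v = 1, e v = 1 - v = x.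
    ev≈x : e * v ≈ x
    ev≈x = +-cancelʳ v _ _ (begin
      e * v + v        ≈⟨ +-congˡ (*-identityˡ v) ⟨
      e * v + 1# * v   ≈⟨ distribʳ v e 1# ⟨
      (e + 1#) * v     ≈⟨ *-congʳ f≈ ⟨
      f * v            ≈⟨ fv≈1 ⟩
      1#               ≈⟨ v≈ ⟨
      v + x            ≈⟨ +-comm v x ⟩
      x + v            ∎)

  -- The recurrence for h′ has the shape of `linear-fixpoint` with r = x h f′; the second factor v′
  -- then meets f′, and f′ v′ = v restores h v².
  once-step : ∀ {x u v v′ f f′ h h′ p} → v′ + x * u ≈ v → f * v ≈ u →
    f′ * v′ ≈ v → h * (v * v) ≈ p →
    h′ ≈ x * (h * f′ + f * h′) → h′ * (v′ * v′) ≈ x * p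
  once-step {x} {u} {v} {v′} {f} {f′} {h} {h′} {p} v≈ fv≈u f′v′≈v hvv≈p h′≈ = begin
    h′ * (v′ * v′)              ≈⟨ *-assoc h′ v′ v′ ⟨
    h′ * v′ * v′                ≈⟨ *-congʳ (linear-fixpoint v≈ fv≈u (trans h′≈ (distribˡ x _ _))) ⟩
    x * (h * f′) * v * v′       ≈⟨ regroup x h f′ v v′ ⟩
    x * (h * (v * (f′ * v′)))   ≈⟨ *-congˡ (*-congˡ (*-congˡ f′v′≈v)) ⟩
    x * (h * (v * v))           ≈⟨ *-congˡ hvv≈p ⟩
    x * p                       ∎
    where
    regroup : ∀ x h f′ v v′ →
      x * (h * f′) * v * v′ ≈ x * (h * (v * (f′ * v′)))
    regroup = solve 5 (λ x h f′ v v′ →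
      x :* (h :* f′) :* v :* v′ := x :* (h :* (v :* (f′ :* v′)))) refl

open import Algebra.Construct.Pointwise ℕ using (isAbelianGroup)
open import Data.Bool using (Bool; true; false; not; _∧_; T)
open import Data.Bool.Properties using (∧-assoc; ∧-identityʳ; ∧-zeroʳ; not-injective; T-∧; T?)
import Data.Integer as ℤ
import Data.Integer.Properties as ℤ
open import Data.Integer.Tactic.RingSolver using () renaming (solve-∀ to ℤ-solve-∀)
open import Data.List using (List; []; _∷_; _++_; _∷ʳ_; map; concatMap; length; filter; null;
  replicate; upTo; initLast; _∷ʳ′_)
open import Data.List.Membership.Propositional using (_∈_)
open import Data.List.Membership.Propositional.Properties using (∈-++⁺ˡ; ∈-++⁺ʳ; ∈-++⁻)
open import Data.List.Properties using (map-∘; map-++; map-cong; map-id; upTo-∷ʳ; ++-assoc)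
open import Data.List.Relation.Binary.Sublist.Propositional using (_⊆_; []; _∷_; from∈)
  renaming (_∷ʳ_ to skip)
open import Data.List.Relation.Binary.Sublist.Propositional.Properties using (++⁺)
open import Data.List.Relation.Unary.All as All using (All; []; _∷_)
import Data.List.Relation.Unary.All.Properties as All
open import Data.List.Relation.Unary.Any using (here; there)
open import Data.List.Reverse using (Reverse; []; _∶_∶ʳ_; reverseView)
open import Data.Nat using (zero; suc; _+_; _*_; _∸_; _<_; _<ᵇ_; s≤s; z≤n)
open import Data.Nat.ListAction using (sum)
open import Data.Nat.ListAction.Properties using (sum-++)
open import Data.Nat.Properties
open import Data.Nat.Tactic.RingSolver using (solve-∀)
open import Data.Product using (_×_; _,_; proj₁; proj₂; map₁; uncurry; ∃-syntax)
open import Data.Sum using (_⊎_; inj₁; inj₂)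
open import Data.Unit using (tt)
open import Function using (_∘_; const; id; Equivalence)
open import Level using (0ℓ)
open import Relation.Binary.Definitions using (tri<; tri≈; tri>)
open import Relation.Binary.PropositionalEquality
  using (_≗_; refl; sym; trans; cong; cong₂; subst; module ≡-Reasoning)
open import Relation.Nullary using (¬_; contradiction)
open ≡-Reasoning

private variable
  A B : Set

-- Formal power series

Series : Set
Series = ℕ → ℤ

infixl 6 _⊞_
infixl 7 _⊛_
infixr 7 _·_

_⊞_ : Series → Series → Series
(a ⊞ b) n = a n ℤ.+ b n

_·_ : ℤ → Series → Series
(c · a) n = c ℤ.* a n

tail : Series → Series
tail a = a ∘ suc

-- The Cauchy product, read off from a = a 0 + x · `tail a`. Recursion on the index replaces finite
-- sums, so the ring laws follow by induction on n for all series at once.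
_⊛_ : Series → Series → Series
(a ⊛ b) zero    = a 0 ℤ.* b 0
(a ⊛ b) (suc n) = a 0 ℤ.* b (suc n) ℤ.+ (tail a ⊛ b) n

𝟙 X : Series
𝟙 zero          = + 1
𝟙 (suc _)       = + 0
X zero          = + 0
X (suc n)       = 𝟙 n

⊛-cong : ∀ {a a′ b b′} → a ≗ a′ → b ≗ b′ → a ⊛ b ≗ a′ ⊛ b′
⊛-cong p q zero    = cong₂ ℤ._*_ (p 0) (q 0)
⊛-cong p q (suc n) =
  cong₂ ℤ._+_ (cong₂ ℤ._*_ (p 0) (q (suc n))) (⊛-cong (p ∘ suc) q n)

⊛-zeroˡ : ∀ a → const (+ 0) ⊛ a ≗ const (+ 0)
⊛-zeroˡ a zero    = refl
⊛-zeroˡ a (suc n) = cong (ℤ._+_ (+ 0)) (⊛-zeroˡ a n)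

⊛-distribʳ-⊞ : ∀ c a b → (a ⊞ b) ⊛ c ≗ a ⊛ c ⊞ b ⊛ c
⊛-distribʳ-⊞ c a b zero    = ℤ.*-distribʳ-+ (c 0) (a 0) (b 0)
⊛-distribʳ-⊞ c a b (suc n) rewrite ⊛-distribʳ-⊞ c (tail a) (tail b) n =
  rearrange (a 0) (b 0) (c (suc n)) ((tail a ⊛ c) n) ((tail b ⊛ c) n)
  where
  rearrange : ∀ a b c x y →
    (a ℤ.+ b) ℤ.* c ℤ.+ (x ℤ.+ y) ≡ (a ℤ.* c ℤ.+ x) ℤ.+ (b ℤ.* c ℤ.+ y)
  rearrange = ℤ-solve-∀

·-⊛-assoc : ∀ c a b → (c · a) ⊛ b ≗ c · (a ⊛ b)
·-⊛-assoc c a b zero    = ℤ.*-assoc c (a 0) (b 0)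
·-⊛-assoc c a b (suc n) rewrite ·-⊛-assoc c (tail a) b n =
  rearrange c (a 0) (b (suc n)) ((tail a ⊛ b) n)
  where
  rearrange : ∀ c a b x → c ℤ.* a ℤ.* b ℤ.+ c ℤ.* x ≡ c ℤ.* (a ℤ.* b ℤ.+ x)
  rearrange = ℤ-solve-∀

-- Mirror image of the defining recursion, splitting the right factor instead of the left;
-- commutativity is where the two meet.
⊛-tailʳ : ∀ a b n → (a ⊛ b) (suc n) ≡ b 0 ℤ.* a (suc n) ℤ.+ (a ⊛ tail b) n
⊛-tailʳ a b zero    = rearrange (a 0) (b 0) (a 1) (b 1)
  where
  rearrange : ∀ a b a′ b′ → a ℤ.* b′ ℤ.+ a′ ℤ.* b ≡ b ℤ.* a′ ℤ.+ a ℤ.* b′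
  rearrange = ℤ-solve-∀
⊛-tailʳ a b (suc n) rewrite ⊛-tailʳ (tail a) b n =
  rearrange (a 0 ℤ.* b (suc (suc n))) (b 0 ℤ.* a (suc (suc n))) ((tail a ⊛ tail b) n)
  where
  rearrange : ∀ x y z → x ℤ.+ (y ℤ.+ z) ≡ y ℤ.+ (x ℤ.+ z)
  rearrange = ℤ-solve-∀

⊛-comm : ∀ a b → a ⊛ b ≗ b ⊛ a
⊛-comm a b zero    = ℤ.*-comm (a 0) (b 0)
⊛-comm a b (suc n) =
  trans (cong (ℤ._+_ (a 0 ℤ.* b (suc n))) (⊛-comm (tail a) b n)) (sym (⊛-tailʳ b a n))

⊛-assoc : ∀ a b c → (a ⊛ b) ⊛ c ≗ a ⊛ (b ⊛ c)
⊛-assoc a b c zero    = ℤ.*-assoc (a 0) (b 0) (c 0)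
⊛-assoc a b c (suc n)
  -- By definition `tail (a ⊛ b)` is `a 0 · tail b ⊞ tail a ⊛ b`.
  rewrite ⊛-distribʳ-⊞ c (a 0 · tail b) (tail a ⊛ b) n
        | ·-⊛-assoc (a 0) (tail b) c n
        | ⊛-assoc (tail a) b c n =
  rearrange (a 0) (b 0) (c (suc n)) ((tail b ⊛ c) n) ((tail a ⊛ (b ⊛ c)) n)
  where
  rearrange : ∀ a b c x y →
    a ℤ.* b ℤ.* c ℤ.+ (a ℤ.* x ℤ.+ y) ≡ a ℤ.* (b ℤ.* c ℤ.+ x) ℤ.+ y
  rearrange = ℤ-solve-∀

⊛-identityˡ : ∀ a → 𝟙 ⊛ a ≗ a
⊛-identityˡ a zero    = ℤ.*-identityˡ (a 0)
⊛-identityˡ a (suc n) =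
  trans (cong₂ ℤ._+_ (ℤ.*-identityˡ (a (suc n))) (⊛-zeroˡ a n)) (ℤ.+-identityʳ _)

X⊛-suc : ∀ a n → (X ⊛ a) (suc n) ≡ a n
X⊛-suc a n = trans (ℤ.+-identityˡ _) (⊛-identityˡ a n)

seriesRing : CommutativeRing 0ℓ 0ℓ
seriesRing = record
  { Carrier = Series
  ; _≈_ = _≗_
  ; _+_ = _⊞_
  ; _*_ = _⊛_
  ; -_ = λ a n → ℤ.- a n
  ; 0# = const (+ 0)
  ; 1# = 𝟙
  ; isCommutativeRing = record
    { isRing = record
      { +-isAbelianGroup = isAbelianGroup ℤ.+-0-isAbelianGroup
      ; *-cong = ⊛-cong
      ; *-assoc = ⊛-assoc
      ; *-identity = ⊛-identityˡ , λ a n → trans (⊛-comm a 𝟙 n) (⊛-identityˡ a n)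
      ; distrib =
          (λ c a b n → trans (⊛-comm c (a ⊞ b) n)
            (trans (⊛-distribʳ-⊞ c a b n)
              (cong₂ ℤ._+_ (⊛-comm a c n) (⊛-comm b c n))))
        , ⊛-distribʳ-⊞
      }
    ; *-comm = ⊛-comm
    }
  }

-- Polynomials as power series

coeff-⊕ : ∀ p q → coeff (p ⊕ q) ≗ coeff p ⊞ coeff q
coeff-⊕ []      q       n       = sym (ℤ.+-identityˡ _)
coeff-⊕ (a ∷ p) []      n       = sym (ℤ.+-identityʳ _)
coeff-⊕ (a ∷ p) (b ∷ q) zero    = refl
coeff-⊕ (a ∷ p) (b ∷ q) (suc n) = coeff-⊕ p q n

coeff-scale : ∀ c p → coeff (scale c p) ≗ c · coeff p
coeff-scale c []      n       = sym (ℤ.*-zeroʳ c)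
coeff-scale c (a ∷ p) zero    = refl
coeff-scale c (a ∷ p) (suc n) = coeff-scale c p n

coeff-⊗ : ∀ p q → coeff (p ⊗ q) ≗ coeff p ⊛ coeff q
coeff-⊗ [] q n = sym (⊛-zeroˡ (coeff q) n)
coeff-⊗ (a ∷ p) q zero
  rewrite coeff-⊕ (scale a q) (+ 0 ∷ (p ⊗ q)) 0 | coeff-scale a q 0 = ℤ.+-identityʳ _
coeff-⊗ (a ∷ p) q (suc n)
  rewrite coeff-⊕ (scale a q) (+ 0 ∷ (p ⊗ q)) (suc n) | coeff-scale a q (suc n) =
  cong (ℤ._+_ (a ℤ.* coeff q (suc n))) (coeff-⊗ p q n)

-- u plays the role of the partial sums i ↦ Σ_{j ≤ i} a j · b (n ∸ j).
partialSum-⊛ : ∀ (a b : Series) n (u : Series) →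
  u 0 ≡ a 0 ℤ.* b n →
  (∀ i → u (suc i) ≡ a (suc i) ℤ.* b (n ∸ suc i) ℤ.+ u i) →
  ∀ i d → n ≡ i + d → u i ≡ ((λ j → b (d + j)) ⊛ a) i
partialSum-⊛ a b n u u₀ uₛ zero d refl =
  trans u₀ (trans (ℤ.*-comm (a 0) (b d)) (cong (λ e → b e ℤ.* a 0) (sym (+-identityʳ d))))
partialSum-⊛ a b n u u₀ uₛ (suc i) d eq = trans (uₛ i) (cong₂ ℤ._+_ hd tl)
  where
  hd : a (suc i) ℤ.* b (n ∸ suc i) ≡ b (d + 0) ℤ.* a (suc i)
  hd rewrite eq | m+n∸m≡n i d | +-identityʳ d = ℤ.*-comm (a (suc i)) (b d)
  tl : u i ≡ ((λ j → b (d + suc j)) ⊛ a) i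
  tl = trans (partialSum-⊛ a b n u u₀ uₛ i (suc d) (trans eq (sym (+-suc i d))))
             (⊛-cong (λ j → cong b (sym (+-suc d j))) (λ _ → refl) i)

-- convCoeff sums with a local function that has no name outside Defs; the
-- unification problem in convCoeff-⊛ determines partialSum to be that function.
mutual
  partialSum : Series → Poly → ℕ → ℕ → ℤ
  partialSum = _

  convCoeff-⊛ : ∀ a q → convCoeff a q ≗ a ⊛ coeff q
  convCoeff-⊛ a q zero = refl
  convCoeff-⊛ a q (suc m) with suc m in eq
  ... | n = trans (cong (ℤ._+_ (a n ℤ.* coeff q (m ∸ m)))
                    (partialSum-⊛ a (coeff q) n (partialSum a q n) refl (λ _ → refl)
                      m 1 (trans (sym eq) (+-comm 1 m))))
                  (top n eq)
    where
    top : ∀ n → suc m ≡ n →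
      a n ℤ.* coeff q (m ∸ m) ℤ.+ (tail (coeff q) ⊛ a) m
        ≡ a 0 ℤ.* coeff q n ℤ.+ (tail a ⊛ coeff q) m
    top _ refl rewrite n∸n≡0 m =
      trans (cong (ℤ._+ (tail (coeff q) ⊛ a) m) (ℤ.*-comm (a (suc m)) (coeff q 0)))
            (⊛-comm (coeff q) a (suc m))

-- Sums over permutations

<ᵇ-true : ∀ {m n} → m < n → (m <ᵇ n) ≡ true
<ᵇ-true {m} {n} m<n with m <ᵇ n | <⇒<ᵇ m<n
... | true | _ = refl

<ᵇ-false : ∀ {m n} → n ≤ m → (m <ᵇ n) ≡ false
<ᵇ-false {m} {n} n≤m with m <ᵇ n | <ᵇ⇒< m n
... | true  | lt = contradiction (lt tt) (≤⇒≯ n≤m)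
... | false | _  = refl

⟦_⟧ : Bool → ℕ
⟦ true ⟧  = 1
⟦ false ⟧ = 0

∑ : (A → ℕ) → List A → ℕ
∑ f xs = sum (map f xs)

∑-cong : {f g : A → ℕ} → f ≗ g → ∀ xs → ∑ f xs ≡ ∑ g xs
∑-cong f≗g xs = cong sum (map-cong f≗g xs)

∑-congAll : {f g : A → ℕ} {xs : List A} → All (λ x → f x ≡ g x) xs → ∑ f xs ≡ ∑ g xs
∑-congAll []       = refl
∑-congAll (e ∷ es) = cong₂ _+_ e (∑-congAll es)

∑-zero : (xs : List A) → ∑ (const 0) xs ≡ 0
∑-zero []       = refl
∑-zero (x ∷ xs) = ∑-zero xs

∑-++ : (f : A → ℕ) → ∀ xs ys → ∑ f (xs ++ ys) ≡ ∑ f xs + ∑ f ys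
∑-++ f xs ys = trans (cong sum (map-++ f xs ys)) (sum-++ (map f xs) (map f ys))

∑-map : (f : B → ℕ) (h : A → B) → ∀ xs → ∑ f (map h xs) ≡ ∑ (f ∘ h) xs
∑-map f h xs = cong sum (sym (map-∘ xs))

∑-concatMap : (f : B → ℕ) (h : A → List B) → ∀ xs → ∑ f (concatMap h xs) ≡ ∑ (∑ f ∘ h) xs
∑-concatMap f h []       = refl
∑-concatMap f h (x ∷ xs) =
  trans (∑-++ f (h x) (concatMap h xs)) (cong (_+_ (∑ f (h x))) (∑-concatMap f h xs))

interchange : ∀ a b c d → (a + b) + (c + d) ≡ (a + c) + (b + d)
interchange = solve-∀

∑-+ : (f g : A → ℕ) → ∀ xs → ∑ (λ x → f x + g x) xs ≡ ∑ f xs + ∑ g xs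
∑-+ f g []       = refl
∑-+ f g (x ∷ xs) =
  trans (cong (_+_ (f x + g x)) (∑-+ f g xs)) (interchange (f x) (g x) (∑ f xs) (∑ g xs))

∑-*ˡ : ∀ c (f : A → ℕ) xs → ∑ (λ x → c * f x) xs ≡ c * ∑ f xs
∑-*ˡ c f []       = sym (*-zeroʳ c)
∑-*ˡ c f (x ∷ xs) = trans (cong (_+_ (c * f x)) (∑-*ˡ c f xs)) (sym (*-distribˡ-+ c (f x) (∑ f xs)))

∑-comm : (f : A → B → ℕ) → ∀ xs ys →
  ∑ (λ x → ∑ (f x) ys) xs ≡ ∑ (λ y → ∑ (λ x → f x y) xs) ys
∑-comm f []       ys = sym (∑-zero ys)
∑-comm f (x ∷ xs) ys =
  trans (cong (_+_ (∑ (f x) ys)) (∑-comm f xs ys)) (sym (∑-+ (f x) _ ys))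

∑-× : (f : A → ℕ) (g : B → ℕ) → ∀ xs ys →
  ∑ (λ x → ∑ (λ y → f x * g y) ys) xs ≡ ∑ f xs * ∑ g ys
∑-× f g xs ys = begin
  ∑ (λ x → ∑ (λ y → f x * g y) ys) xs ≡⟨ ∑-cong (λ x → ∑-*ˡ (f x) g ys) xs ⟩
  ∑ (λ x → f x * ∑ g ys) xs           ≡⟨ ∑-cong (λ x → *-comm (f x) (∑ g ys)) xs ⟩
  ∑ (λ x → ∑ g ys * f x) xs           ≡⟨ ∑-*ˡ (∑ g ys) f xs ⟩
  ∑ g ys * ∑ f xs                     ≡⟨ *-comm (∑ g ys) (∑ f xs) ⟩
  ∑ f xs * ∑ g ys                     ∎

-- Cutting a word and inserting a maximum

splits : List A → List (List A × List A)
splits []       = ([] , []) ∷ []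
splits (x ∷ xs) = ([] , x ∷ xs) ∷ map (map₁ (x ∷_)) (splits xs)

splits-All : ∀ {P : A → Set} {xs} → All P xs → All (λ s → All P (proj₁ s) × All P (proj₂ s)) (splits xs)
splits-All []         = ([] , []) ∷ []
splits-All (px ∷ pxs) =
  ([] , px ∷ pxs) ∷ All.map⁺ (All.map (λ (p , q) → px ∷ p , q) (splits-All pxs))

∑-inserts : ∀ f x π → ∑ f (inserts x π) ≡ ∑ (λ (α , β) → f (α ++ x ∷ β)) (splits π)
∑-inserts f x []       = refl
∑-inserts f x (y ∷ ys) = cong (_+_ (f (x ∷ y ∷ ys))) (begin
  ∑ f (map (y ∷_) (inserts x ys))                       ≡⟨ ∑-map f (y ∷_) (inserts x ys) ⟩
  ∑ (f ∘ (y ∷_)) (inserts x ys)                         ≡⟨ ∑-inserts (f ∘ (y ∷_)) x ys ⟩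
  ∑ (λ (α , β) → f (y ∷ α ++ x ∷ β)) (splits ys)        ≡⟨ ∑-map _ (map₁ (y ∷_)) (splits ys) ⟨
  ∑ (λ (α , β) → f (α ++ x ∷ β)) (map (map₁ (y ∷_)) (splits ys)) ∎)

-- Inserting x and cutting commute: after the cut, x sits in one of the two parts. The weight is
-- arbitrary because passing the first letter y replaces `u` by `u ∘ (y ∷_)`.
∑-splits-inserts : ∀ (u : List ℕ → List ℕ → ℕ) x π →
  ∑ (∑ (uncurry u) ∘ splits) (inserts x π)
    ≡ ∑ (λ (α , β) → ∑ (λ α′ → u α′ β) (inserts x α) + ∑ (u α) (inserts x β)) (splits π)
∑-splits-inserts u x []       = rearrange (u [] (x ∷ [])) (u (x ∷ []) [])
  where
  rearrange : ∀ a b → a + (b + 0) + 0 ≡ b + 0 + (a + 0) + 0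
  rearrange = solve-∀
∑-splits-inserts u x (y ∷ ys) = begin
  a + (b + ∑ (uncurry u) (map (map₁ (x ∷_)) (map (map₁ (y ∷_)) (splits ys))))
    + ∑ (∑ (uncurry u) ∘ splits) (map (y ∷_) (inserts x ys))
      ≡⟨ cong₂ (λ p q → a + (b + p) + q)
           (trans (∑-map _ (map₁ (x ∷_)) (map (map₁ (y ∷_)) (splits ys))) (∑-map _ (map₁ (y ∷_)) (splits ys)))
           (trans (∑-map _ (y ∷_) (inserts x ys)) (∑-+ (u [] ∘ (y ∷_)) _ (inserts x ys))) ⟩
  a + (b + c) + (d + ∑ (λ π → ∑ (uncurry u) (map (map₁ (y ∷_)) (splits π))) (inserts x ys))
      ≡⟨ cong (λ q → a + (b + c) + (d + q)) (begin
           ∑ (λ π → ∑ (uncurry u) (map (map₁ (y ∷_)) (splits π))) (inserts x ys)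
             ≡⟨ ∑-cong (λ π → ∑-map (uncurry u) (map₁ (y ∷_)) (splits π)) (inserts x ys) ⟩
           ∑ (∑ (uncurry (u ∘ (y ∷_))) ∘ splits) (inserts x ys)
             ≡⟨ ∑-splits-inserts (u ∘ (y ∷_)) x ys ⟩
           ∑ (λ (α , β) → l α β + r α β) (splits ys) ∎) ⟩
  a + (b + c) + (d + ∑ (λ (α , β) → l α β + r α β) (splits ys))
      ≡⟨ arrange a b c d _ ⟩
  b + 0 + (a + d) + (c + ∑ (λ (α , β) → l α β + r α β) (splits ys))
      ≡⟨ cong (_+_ (b + 0 + (a + d))) (begin
           c + ∑ (λ (α , β) → l α β + r α β) (splits ys)
             ≡⟨ ∑-+ (λ (α , β) → u (x ∷ y ∷ α) β) _ (splits ys) ⟨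
           ∑ (λ (α , β) → u (x ∷ y ∷ α) β + (l α β + r α β)) (splits ys)
             ≡⟨ ∑-cong (λ (α , β) → trans (sym (+-assoc (u (x ∷ y ∷ α) β) _ _))
                  (cong (λ z → u (x ∷ y ∷ α) β + z + r α β)
                    (sym (∑-map _ (y ∷_) (inserts x α))))) (splits ys) ⟩
           ∑ (λ (α , β) → ∑ (λ α′ → u α′ β) (inserts x (y ∷ α)) + r α β) (splits ys)
             ≡⟨ ∑-map _ (map₁ (y ∷_)) (splits ys) ⟨
           ∑ (λ (α , β) → ∑ (λ α′ → u α′ β) (inserts x α) + ∑ (u α) (inserts x β))
             (map (map₁ (y ∷_)) (splits ys)) ∎) ⟩
  b + 0 + (a + d) + e
      ≡⟨ cong (λ z → b + 0 + (a + z) + e) (∑-map (u []) (y ∷_) (inserts x ys)) ⟨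
  _ ∎
  where
  -- `a`, `b`, `c`: x stands before y, and the cut is before x, between them, or after y. `d`: x is
  -- behind y and the cut before y. `l`, `r`: y is left of the cut, and x is behind y in the left
  -- part or in the right part.
  a = u [] (x ∷ y ∷ ys)
  b = u (x ∷ []) (y ∷ ys)
  c = ∑ (λ (α , β) → u (x ∷ y ∷ α) β) (splits ys)
  d = ∑ (u [] ∘ (y ∷_)) (inserts x ys)
  e = ∑ (λ (α , β) → ∑ (λ α′ → u α′ β) (inserts x α) + ∑ (u α) (inserts x β))
        (map (map₁ (y ∷_)) (splits ys))
  l r : List ℕ → List ℕ → ℕ
  l α β = ∑ (λ α′ → u (y ∷ α′) β) (inserts x α)
  r α β = ∑ (u (y ∷ α)) (inserts x β)
  arrange : ∀ a b c d e → a + (b + c) + (d + e) ≡ b + 0 + (a + d) + (c + e)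
  arrange = solve-∀

-- The weak form makes a failure yield a < b at once, which are the 1 and the 2 of a 1-3-2 around
-- the maximum.
dominates : List ℕ → List ℕ → Bool
dominates α β = allB (λ a → allB (λ b → not (a <ᵇ b)) β) α

allB-true : ∀ {p : A → Bool} {xs} → All (λ x → p x ≡ true) xs → allB p xs ≡ true
allB-true []       = refl
allB-true (e ∷ es) rewrite e = allB-true es

dominates-insertsˡ : ∀ {x β} α → All (_< x) β →
  All (λ α′ → dominates α′ β ≡ dominates α β) (inserts x α)
dominates-insertsˡ {x} {β} α β<x = go α
  where
  x-row : ∀ α → dominates (x ∷ α) β ≡ dominates α β
  x-row α = cong (_∧ dominates α β)
    (allB-true (All.map (λ b<x → cong not (<ᵇ-false (<⇒≤ b<x))) β<x))
  go : ∀ α → All (λ α′ → dominates α′ β ≡ dominates α β) (inserts x α)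
  go []      = x-row [] ∷ []
  go (a ∷ α) = x-row (a ∷ α) ∷ All.map⁺ (All.map (cong (_ ∧_)) (go α))

dominates-insertsʳ : ∀ {x a} α β → a < x →
  All (λ β′ → dominates (a ∷ α) β′ ≡ false) (inserts x β)
dominates-insertsʳ {x} {a} α β a<x = All.map (λ {β′} e → cong (_∧ dominates α β′) e) (go β)
  where
  x-entry : ∀ β → allB (λ b → not (a <ᵇ b)) (x ∷ β) ≡ false
  x-entry β rewrite <ᵇ-true a<x = refl
  go : ∀ β → All (λ β′ → allB (λ b → not (a <ᵇ b)) β′ ≡ false) (inserts x β)
  go []      = x-entry [] ∷ []
  go (b ∷ β) = x-entry (b ∷ β) ∷
    All.map⁺ (All.map (λ e → trans (cong (not (a <ᵇ b) ∧_) e) (∧-zeroʳ _)) (go β))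

∑-dominating-splits : (List ℕ → List ℕ → ℕ) → List ℕ → ℕ
∑-dominating-splits w π = ∑ (λ (α , β) → ⟦ dominates α β ⟧ * w α β) (splits π)

-- Moves an insertion into the weight, so that an induction over all weights can absorb it.
insertLeft : ℕ → (List ℕ → List ℕ → ℕ) → List ℕ → List ℕ → ℕ
insertLeft x w α β = ∑ (λ α′ → w α′ β) (inserts x α)

-- A maximum inserted into the right part destroys dominance unless the left part is empty.
∑-dominating-splits-inserts : ∀ w {x π} → All (_< x) π →
  ∑ (∑-dominating-splits w) (inserts x π)
    ≡ ∑ (w []) (inserts x π) + ∑-dominating-splits (insertLeft x w) π
∑-dominating-splits-inserts w {x} {π} π<x = begin
  ∑ (∑-dominating-splits w) (inserts x π)                              ≡⟨ ∑-splits-inserts u x π ⟩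
  ∑ (λ (α , β) → insertLeft x u α β + ∑ (u α) (inserts x β)) (splits π) ≡⟨ ∑-+ (uncurry (insertLeft x u)) _ (splits π) ⟩
  ∑ (uncurry (insertLeft x u)) (splits π) + ∑ (λ (α , β) → ∑ (u α) (inserts x β)) (splits π)
                                              ≡⟨ cong₂ _+_ left (right π<x) ⟩
  ∑-dominating-splits (insertLeft x w) π + ∑ (w []) (inserts x π)
                                              ≡⟨ +-comm (∑-dominating-splits (insertLeft x w) π) _ ⟩
  ∑ (w []) (inserts x π) + ∑-dominating-splits (insertLeft x w) π ∎
  where
  u : List ℕ → List ℕ → ℕ
  u α β = ⟦ dominates α β ⟧ * w α β
  left : ∑ (uncurry (insertLeft x u)) (splits π) ≡ ∑-dominating-splits (insertLeft x w) π
  left = ∑-congAll (All.map (λ {(α , β)} (_ , β<x) → trans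
    (∑-congAll (All.map (λ {α′} e → cong (λ d → ⟦ d ⟧ * w α′ β) e) (dominates-insertsˡ α β<x)))
    (∑-*ˡ ⟦ dominates α β ⟧ (λ α′ → w α′ β) (inserts x α))) (splits-All π<x))
  right : ∀ {π} → All (_< x) π →
    ∑ (λ (α , β) → ∑ (u α) (inserts x β)) (splits π) ≡ ∑ (w []) (inserts x π)
  right {[]}    _         = trans (+-identityʳ _) (∑-cong (λ β → *-identityˡ (w [] β)) (inserts x []))
  right {y ∷ π} (y<x ∷ _) = trans (cong₂ _+_
    (∑-cong (λ β → *-identityˡ (w [] β)) (inserts x (y ∷ π)))
    (trans (∑-map _ (map₁ (y ∷_)) (splits π))
      (trans (∑-cong (λ (α , β) → trans
                (∑-congAll (All.map (λ {β′} e → cong (λ d → ⟦ d ⟧ * w (y ∷ α) β′) e)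
                  (dominates-insertsʳ α β y<x)))
                (∑-zero (inserts x β))) (splits π))
        (∑-zero (splits π)))))
    (+-identityʳ _)

inserts-All : ∀ {P : ℕ → Set} {x π} → P x → All P π → All (All P) (inserts x π)
inserts-All px []         = (px ∷ []) ∷ []
inserts-All px (py ∷ pys) = (px ∷ py ∷ pys) ∷ All.map⁺ (All.map (py ∷_) (inserts-All px pys))

S-bound : ∀ n → All (All (_< suc n)) (S n)
S-bound zero    = [] ∷ []
S-bound (suc n) = All.concat⁺ (All.map⁺ (All.map
  (λ π<n → inserts-All ≤-refl (All.map m<n⇒m<1+n π<n)) (S-bound n)))

map-inserts : ∀ j x σ → inserts (j + x) (map (_+_ j) σ) ≡ map (map (_+_ j)) (inserts x σ)
map-inserts j x []      = refl
map-inserts j x (y ∷ σ) = cong (_∷_ (map (_+_ j) (x ∷ y ∷ σ))) (begin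
  map (_∷_ (j + y)) (inserts (j + x) (map (_+_ j) σ))     ≡⟨ cong (map _) (map-inserts j x σ) ⟩
  map (_∷_ (j + y)) (map (map (_+_ j)) (inserts x σ))     ≡⟨ map-∘ (inserts x σ) ⟨
  map (map (_+_ j) ∘ (y ∷_)) (inserts x σ)             ≡⟨ map-∘ (inserts x σ) ⟩
  map (map (_+_ j)) (map (y ∷_) (inserts x σ))         ∎)

-- These pairs are a permutation of the m largest and one of the j smallest values of {1, ..., m +
-- j}.
block : ℕ → ℕ → (List ℕ → List ℕ → ℕ) → ℕ
block m j w = ∑ (λ σ → ∑ (w (map (_+_ j) σ)) (S j)) (S m)

-- Left sizes run from m to m + n and right sizes from n down to 0. The lower end is a parameter so
-- that all left sizes can be raised by one.
convolution : ℕ → ℕ → (List ℕ → List ℕ → ℕ) → ℕ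
convolution m zero    w = block m 0 w
convolution m (suc n) w = block m (suc n) w + convolution (suc m) n w

block-insertLeft : ∀ m j w → block m j (insertLeft (j + suc m) w) ≡ block (suc m) j w
block-insertLeft m j w = begin
  ∑ (λ σ → ∑ (λ ρ → ∑ (λ α → w α ρ) (inserts (j + suc m) (map (_+_ j) σ))) (S j)) (S m)
    ≡⟨ ∑-cong (λ σ → begin
         ∑ (λ ρ → ∑ (λ α → w α ρ) (inserts (j + suc m) (map (_+_ j) σ))) (S j)
           ≡⟨ ∑-cong (λ ρ → trans (cong (∑ (λ α → w α ρ)) (map-inserts j (suc m) σ))
                (∑-map (λ α → w α ρ) (map (_+_ j)) (inserts (suc m) σ))) (S j) ⟩
         ∑ (λ ρ → ∑ (λ σ′ → w (map (_+_ j) σ′) ρ) (inserts (suc m) σ)) (S j)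
           ≡⟨ ∑-comm (λ ρ σ′ → w (map (_+_ j) σ′) ρ) (S j) (inserts (suc m) σ) ⟩
         ∑ (λ σ′ → ∑ (w (map (_+_ j) σ′)) (S j)) (inserts (suc m) σ) ∎) (S m) ⟩
  ∑ (λ σ → ∑ (λ σ′ → ∑ (w (map (_+_ j) σ′)) (S j)) (inserts (suc m) σ)) (S m)
    ≡⟨ ∑-concatMap (λ σ′ → ∑ (w (map (_+_ j) σ′)) (S j)) (inserts (suc m)) (S m) ⟨
  block (suc m) j w ∎

-- The two sizes have the same total m + n in every block, so one new maximum serves all of them.
convolution-insertLeft : ∀ m n w →
  convolution m n (insertLeft (n + suc m) w) ≡ convolution (suc m) n w
convolution-insertLeft m zero    w = block-insertLeft m 0 w
convolution-insertLeft m (suc n) w = cong₂ _+_ (block-insertLeft m (suc n) w)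
  (trans (cong (λ x → convolution (suc m) n (insertLeft x w)) (sym (+-suc n (suc m))))
    (convolution-insertLeft (suc m) n w))

-- Induction on n for all weights. If the new maximum lies right of the cut, dominance leaves only
-- an empty left part, which is the block (0, n + 1); otherwise it enlarges the left part, turning
-- each block (m, j) of size n into (m + 1, j).
∑-dominating-splits-S : ∀ n w → ∑ (∑-dominating-splits w) (S n) ≡ convolution 0 n w
∑-dominating-splits-S zero    w = cong (λ z → z + 0 + 0) (*-identityˡ (w [] []))
∑-dominating-splits-S (suc n) w = begin
  ∑ (∑-dominating-splits w) (S (suc n))
    ≡⟨ ∑-concatMap (∑-dominating-splits w) (inserts (suc n)) (S n) ⟩
  ∑ (λ π → ∑ (∑-dominating-splits w) (inserts (suc n) π)) (S n)
    ≡⟨ ∑-congAll (All.map (∑-dominating-splits-inserts w) (S-bound n)) ⟩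
  ∑ (λ π → ∑ (w []) (inserts (suc n) π) + ∑-dominating-splits w′ π) (S n)
    ≡⟨ ∑-+ (∑ (w []) ∘ inserts (suc n)) (∑-dominating-splits w′) (S n) ⟩
  ∑ (∑ (w []) ∘ inserts (suc n)) (S n) + ∑ (∑-dominating-splits w′) (S n)
    ≡⟨ cong₂ _+_
         (trans (sym (∑-concatMap (w []) (inserts (suc n)) (S n))) (sym (+-identityʳ _)))
         (trans (∑-dominating-splits-S n w′)
           (trans (cong (λ x → convolution 0 n (insertLeft x w)) (sym (+-comm n 1)))
             (convolution-insertLeft 0 n w))) ⟩
  block 0 (suc n) w + convolution 1 n w ∎
  where w′ = insertLeft (suc n) w

-- The position of the maximum is a cut of the remaining word, so a weight supported on dominating
-- cuts falls under `∑-dominating-splits-S`.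
∑-S-suc : ∀ (W : List ℕ → ℕ) (w : List ℕ → List ℕ → ℕ) →
  (∀ {x α β} → All (_< x) α → All (_< x) β → W (α ++ x ∷ β) ≡ ⟦ dominates α β ⟧ * w α β) →
  ∀ n → ∑ W (S (suc n)) ≡ convolution 0 n w
∑-S-suc W w W-node n = begin
  ∑ W (S (suc n))                          ≡⟨ ∑-concatMap W (inserts (suc n)) (S n) ⟩
  ∑ (∑ W ∘ inserts (suc n)) (S n)          ≡⟨ ∑-congAll (All.map (λ {π} π<n → trans
                                                (∑-inserts W (suc n) π)
                                                (∑-congAll (All.map (uncurry W-node) (splits-All π<n))))
                                                (S-bound n)) ⟩
  ∑ (∑-dominating-splits w) (S n)          ≡⟨ ∑-dominating-splits-S n w ⟩
  convolution 0 n w                        ∎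

convolution-+ : ∀ m n w w′ →
  convolution m n (λ α β → w α β + w′ α β) ≡ convolution m n w + convolution m n w′
convolution-+ m n w w′ = go m n
  where
  block-+ : ∀ m j → block m j (λ α β → w α β + w′ α β) ≡ block m j w + block m j w′
  block-+ m j = trans (∑-cong (λ σ → ∑-+ (w (map (_+_ j) σ)) _ (S j)) (S m)) (∑-+ _ _ (S m))
  go : ∀ m n → convolution m n (λ α β → w α β + w′ α β) ≡ convolution m n w + convolution m n w′
  go m zero    = block-+ m 0
  go m (suc n) = trans (cong₂ _+_ (block-+ m (suc n)) (go (suc m) n))
    (interchange (block m (suc n) w) _ _ _)

genFun : (List ℕ → ℕ) → Series
genFun W n = + ∑ W (S n)

-- Raising α leaves `V α` unchanged, so each block factors into two sums and becomes one term of the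
-- Cauchy product.
convolution-⊛ : ∀ V W → (∀ j σ → V (map (_+_ j) σ) ≡ V σ) →
  ∀ n → + convolution 0 n (λ α β → V α * W β) ≡ (genFun V ⊛ genFun W) n
convolution-⊛ V W V-shift n =
  trans (go 0 n) (⊛-cong (λ i → cong (genFun V) (+-identityʳ i)) (λ _ → refl) n)
  where
  w : List ℕ → List ℕ → ℕ
  w α β = V α * W β
  block-* : ∀ m j → + block m j w ≡ genFun V m ℤ.* genFun W j
  block-* m j = trans
    (cong +_ (trans
      (∑-cong (λ σ → ∑-cong (λ ρ → cong (_* W ρ) (V-shift j σ)) (S j)) (S m))
      (∑-× V W (S m) (S j))))
    (ℤ.pos-* (∑ V (S m)) _)
  go : ∀ m n → + convolution m n w ≡ ((λ i → genFun V (i + m)) ⊛ genFun W) n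
  go m zero    = block-* m 0
  go m (suc n) = trans (ℤ.pos-+ (block m (suc n) w) _) (cong₂ ℤ._+_ (block-* m (suc n))
    (trans (go (suc m) n) (⊛-cong (λ i → cong (genFun V) (+-suc i m)) (λ _ → refl) n)))

-- Counting subsequences

T-injective : ∀ {a b} → (T a → T b) → (T b → T a) → a ≡ b
T-injective {true}  {true}  f g = refl
T-injective {true}  {false} f g = contradiction (f tt) id
T-injective {false} {true}  f g = contradiction (g tt) id
T-injective {false} {false} f g = refl

¬T⇒false : ∀ {a} → ¬ T a → a ≡ false
¬T⇒false ¬a = T-injective ¬a (λ ())

T-∧⁻ : ∀ {a b} → T (a ∧ b) → T a × T b
T-∧⁻ = Equivalence.to T-∧

T-∧⁺ : ∀ {a b} → T a × T b → T (a ∧ b)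
T-∧⁺ = Equivalence.from T-∧

allB-lookup : ∀ {p : A → Bool} {xs x} → T (allB p xs) → x ∈ xs → T (p x)
allB-lookup t (here refl) = proj₁ (T-∧⁻ t)
allB-lookup {p = p} {y ∷ _} t (there x∈) = allB-lookup (proj₂ (T-∧⁻ {p y} t)) x∈

allB-tabulate : ∀ {p : A → Bool} {xs} → (∀ {x} → x ∈ xs → T (p x)) → T (allB p xs)
allB-tabulate {xs = []}     f = tt
allB-tabulate {xs = x ∷ xs} f = T-∧⁺ (f (here refl) , allB-tabulate (f ∘ there))

allB-false : ∀ {p : A → Bool} xs → allB p xs ≡ false → ∃[ x ] x ∈ xs × p x ≡ false
allB-false {p = p} (x ∷ xs) e with p x in px
... | false = x , here refl , px
... | true  with allB-false xs e
... | y , y∈ , py = y , there y∈ , py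

allB-cong : ∀ {p q : A → Bool} → p ≗ q → allB p ≗ allB q
allB-cong e []       = refl
allB-cong e (x ∷ xs) = cong₂ _∧_ (e x) (allB-cong e xs)

allB-map : ∀ (p : B → Bool) (h : A → B) xs → allB p (map h xs) ≡ allB (p ∘ h) xs
allB-map p h []       = refl
allB-map p h (x ∷ xs) = cong (p (h x) ∧_) (allB-map p h xs)

count : (List A → Bool) → List A → ℕ
count P xs = ∑ (⟦_⟧ ∘ P) (subseqs xs)

length-filter : ∀ (P : A → Bool) xs → length (filter (T? ∘ P) xs) ≡ ∑ (⟦_⟧ ∘ P) xs
length-filter P []       = refl
length-filter P (x ∷ xs) with P x
... | true  = cong suc (length-filter P xs)
... | false = length-filter P xs

count-∷ : ∀ (P : List A → Bool) x xs → count P (x ∷ xs) ≡ count (P ∘ (x ∷_)) xs + count P xs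
count-∷ P x xs = trans (∑-++ _ (map (x ∷_) (subseqs xs)) (subseqs xs))
  (cong (_+ count P xs) (∑-map (⟦_⟧ ∘ P) (x ∷_) (subseqs xs)))

count-cong : ∀ {P Q : List A → Bool} → P ≗ Q → ∀ xs → count P xs ≡ count Q xs
count-cong e xs = ∑-cong (cong ⟦_⟧ ∘ e) (subseqs xs)

count-congAll : ∀ {R : A → Set} {P Q : List A → Bool} {xs} →
  (∀ {s} → All R s → P s ≡ Q s) → All R xs → count P xs ≡ count Q xs
count-congAll e [] = cong (λ b → ⟦ b ⟧ + 0) (e [])
count-congAll {P = P} {Q} {x ∷ xs} e (r ∷ rs) = begin
  count P (x ∷ xs)                     ≡⟨ count-∷ P x xs ⟩
  count (P ∘ (x ∷_)) xs + count P xs   ≡⟨ cong₂ _+_ (count-congAll (e ∘ (r ∷_)) rs) (count-congAll e rs) ⟩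
  count (Q ∘ (x ∷_)) xs + count Q xs   ≡⟨ count-∷ Q x xs ⟨
  count Q (x ∷ xs)                     ∎

count-false : (xs : List A) → count (const false) xs ≡ 0
count-false xs = ∑-zero (subseqs xs)

∑-mono : {f g : A → ℕ} → (∀ x → f x ≤ g x) → ∀ xs → ∑ f xs ≤ ∑ g xs
∑-mono f≤g []       = z≤n
∑-mono f≤g (x ∷ xs) = +-mono-≤ (f≤g x) (∑-mono f≤g xs)

count-mono : ∀ {P Q : List A → Bool} → (∀ s → T (P s) → T (Q s)) → ∀ xs → count P xs ≤ count Q xs
count-mono imp xs = ∑-mono (λ s → ⟦⟧-mono (imp s)) (subseqs xs)
  where
  ⟦⟧-mono : ∀ {a b} → (T a → T b) → ⟦ a ⟧ ≤ ⟦ b ⟧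
  ⟦⟧-mono {false} f = z≤n
  ⟦⟧-mono {true} {true} f = ≤-refl
  ⟦⟧-mono {true} {false} f = contradiction (f tt) id

subseqs-map : ∀ (h : A → B) xs → subseqs (map h xs) ≡ map (map h) (subseqs xs)
subseqs-map h []       = refl
subseqs-map h (x ∷ xs) = begin
  map (h x ∷_) (subseqs (map h xs)) ++ subseqs (map h xs)
    ≡⟨ cong (λ z → map (h x ∷_) z ++ z) (subseqs-map h xs) ⟩
  map (h x ∷_) (map (map h) (subseqs xs)) ++ map (map h) (subseqs xs)
    ≡⟨ cong (_++ map (map h) (subseqs xs)) (trans (sym (map-∘ (subseqs xs))) (map-∘ (subseqs xs))) ⟩
  map (map h) (map (x ∷_) (subseqs xs)) ++ map (map h) (subseqs xs)
    ≡⟨ map-++ (map h) (map (x ∷_) (subseqs xs)) (subseqs xs) ⟨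
  map (map h) (map (x ∷_) (subseqs xs) ++ subseqs xs) ∎

count-map : ∀ (P : List B → Bool) (h : A → B) xs → count P (map h xs) ≡ count (P ∘ map h) xs
count-map P h xs = trans (cong (∑ (⟦_⟧ ∘ P)) (subseqs-map h xs)) (∑-map (⟦_⟧ ∘ P) (map h) (subseqs xs))

-- The patterns τ k grow at their right end, hence this recursion from the right.
count-∷ʳ : ∀ (P : List A → Bool) xs x → count P (xs ∷ʳ x) ≡ count P xs + count (λ s → P (s ∷ʳ x)) xs
count-∷ʳ P [] x = trans (+-comm ⟦ P (x ∷ []) ⟧ (⟦ P [] ⟧ + 0)) (cong (_+_ (⟦ P [] ⟧ + 0)) (sym (+-identityʳ _)))
count-∷ʳ P (y ∷ ys) x = begin
  count P (y ∷ ys ∷ʳ x)                                         ≡⟨ count-∷ P y (ys ∷ʳ x) ⟩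
  count (P ∘ (y ∷_)) (ys ∷ʳ x) + count P (ys ∷ʳ x)              ≡⟨ cong₂ _+_ (count-∷ʳ (P ∘ (y ∷_)) ys x) (count-∷ʳ P ys x) ⟩
  count (P ∘ (y ∷_)) ys + count (P ∘ (_∷ʳ x) ∘ (y ∷_)) ys + (count P ys + count (P ∘ (_∷ʳ x)) ys)
                                                                ≡⟨ interchange (count (P ∘ (y ∷_)) ys) _ _ _ ⟩
  count (P ∘ (y ∷_)) ys + count P ys + (count (P ∘ (_∷ʳ x) ∘ (y ∷_)) ys + count (P ∘ (_∷ʳ x)) ys)
                                                                ≡⟨ cong₂ _+_ (count-∷ P y ys) (count-∷ (P ∘ (_∷ʳ x)) y ys) ⟨
  count P (y ∷ ys) + count (P ∘ (_∷ʳ x)) (y ∷ ys)               ∎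

count-⊆ : ∀ {P : List A → Bool} {s xs} → s ⊆ xs → T (P s) → 1 ≤ count P xs
count-⊆ {P = P} [] t with P []
... | true = ≤-refl
count-⊆ {P = P} {xs = y ∷ ys} (skip _ s⊆) t
  rewrite count-∷ P y ys = ≤-trans (count-⊆ s⊆ t) (m≤n+m _ _)
count-⊆ {P = P} {xs = y ∷ ys} (refl ∷ s⊆) t
  rewrite count-∷ P y ys = ≤-trans (count-⊆ {P = P ∘ (y ∷_)} s⊆ t) (m≤m+n _ _)

private
  count-prefix : ∀ {Y : A → Set} {P : List A → Bool} → (∀ s {z} → Y z → P (s ∷ʳ z) ≡ false) →
    ∀ xs {ys} → All Y ys → count P (xs ++ ys) ≡ count P xs
  count-prefix P-false [] [] = refl
  count-prefix {Y = Y} {P} P-false [] {y ∷ ys} (Yy ∷ Yys) = trans (count-∷ P y ys)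
    (cong₂ _+_ (trans (count-congAll none Yys) (count-false ys)) (count-prefix P-false [] Yys))
    where
    none : ∀ {s} → All Y s → P (y ∷ s) ≡ false
    none {s} Ys with initLast s
    ... | []       = P-false [] Yy
    ... | s′ ∷ʳ′ z = P-false (y ∷ s′) (proj₂ (All.∷ʳ⁻ Ys))
  count-prefix {P = P} P-false (x ∷ xs) {ys} Yys = begin
    count P (x ∷ xs ++ ys)
      ≡⟨ count-∷ P x (xs ++ ys) ⟩
    count (P ∘ (x ∷_)) (xs ++ ys) + count P (xs ++ ys)
      ≡⟨ cong₂ _+_ (count-prefix (P-false ∘ (x ∷_)) xs Yys) (count-prefix P-false xs Yys) ⟩
    count (P ∘ (x ∷_)) xs + count P xs
      ≡⟨ count-∷ P x xs ⟨
    count P (x ∷ xs) ∎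

-- A sublist meeting both parts starts at some x of `xs` and ends at some z of `ys`, which `P-false`
-- excludes. `P [] ≡ false` prevents the empty sublist from being counted twice.
count-++ : ∀ {R : A → A → Set} {P : List A → Bool} → P [] ≡ false →
  (∀ x s {z} → R x z → P (x ∷ s ∷ʳ z) ≡ false) →
  ∀ {xs ys} → All (λ x → All (R x) ys) xs → count P (xs ++ ys) ≡ count P xs + count P ys
count-++ {P = P} P[] P-false {ys = ys} [] = cong (λ b → ⟦ b ⟧ + 0 + count P ys) (sym P[])
count-++ {P = P} P[] P-false {x ∷ xs} {ys} (r ∷ rs) = begin
  count P (x ∷ xs ++ ys)
    ≡⟨ count-∷ P x (xs ++ ys) ⟩
  count (P ∘ (x ∷_)) (xs ++ ys) + count P (xs ++ ys)
    ≡⟨ cong₂ _+_ (count-prefix (P-false x) xs r) (count-++ P[] P-false rs) ⟩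
  count (P ∘ (x ∷_)) xs + (count P xs + count P ys)
    ≡⟨ +-assoc (count (P ∘ (x ∷_)) xs) _ _ ⟨
  count (P ∘ (x ∷_)) xs + count P xs + count P ys
    ≡⟨ cong (_+ count P ys) (count-∷ P x xs) ⟨
  count P (x ∷ xs) + count P ys ∎

-- Occurrences as sublists of cells, and their translations

Cell : Set
Cell = ℕ × ℕ

occurrences-count : ∀ p π → occurrences p π ≡ count (isOccurrence p) (indexed 0 π)
occurrences-count p π = length-filter (isOccurrence p) (subseqs (indexed 0 π))

indexed-++ : ∀ i xs ys → indexed i (xs ++ ys) ≡ indexed i xs ++ indexed (i + length xs) ys
indexed-++ i []       ys = cong (λ j → indexed j ys) (sym (+-identityʳ i))
indexed-++ i (x ∷ xs) ys = cong ((i , x) ∷_) (trans (indexed-++ (suc i) xs ys)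
  (cong (λ j → indexed (suc i) xs ++ indexed j ys) (sym (+-suc i (length xs)))))

indexed-All : ∀ {P : ℕ → Set} {i xs} → All P xs → All (P ∘ proj₂) (indexed i xs)
indexed-All []         = []
indexed-All (px ∷ pxs) = px ∷ indexed-All pxs

indexed-∈ : ∀ i {x xs} → x ∈ xs → ∃[ j ] (j , x) ∈ indexed i xs
indexed-∈ i (here refl) = i , here refl
indexed-∈ i (there x∈)  = let j , j∈ = indexed-∈ (suc i) x∈ in j , there j∈

translate : ℕ → ℕ → Cell → Cell
translate a b (i , v) = a + i , b + v

indexed-translate : ∀ a b i xs → indexed (a + i) (map (_+_ b) xs) ≡ map (translate a b) (indexed i xs)
indexed-translate a b i []       = refl
indexed-translate a b i (x ∷ xs) = cong ((a + i , b + x) ∷_)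
  (trans (cong (λ j → indexed j (map (_+_ b) xs)) (sym (+-suc a i))) (indexed-translate a b (suc i) xs))

sameLength-mapʳ : ∀ {C : Set} (h : B → C) (xs : List A) ys → sameLength xs (map h ys) ≡ sameLength xs ys
sameLength-mapʳ h []       []       = refl
sameLength-mapʳ h []       (_ ∷ _)  = refl
sameLength-mapʳ h (_ ∷ _)  []       = refl
sameLength-mapʳ h (_ ∷ xs) (_ ∷ ys) = sameLength-mapʳ h xs ys

pairs-mapʳ : ∀ {C : Set} (h : B → C) (xs : List A) ys →
  pairs xs (map h ys) ≡ map (λ (x , y) → x , h y) (pairs xs ys)
pairs-mapʳ h []       ys       = refl
pairs-mapʳ h (x ∷ xs) []       = refl
pairs-mapʳ h (x ∷ xs) (y ∷ ys) = cong ((x , h y) ∷_) (pairs-mapʳ h xs ys)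

≡ᵇ-+ˡ : ∀ a m n → (a + m ≡ᵇ a + n) ≡ (m ≡ᵇ n)
≡ᵇ-+ˡ zero    m n = refl
≡ᵇ-+ˡ (suc a) m n = ≡ᵇ-+ˡ a m n

<ᵇ-+ˡ : ∀ a m n → (a + m <ᵇ a + n) ≡ (m <ᵇ n)
<ᵇ-+ˡ zero    m n = refl
<ᵇ-+ˡ (suc a) m n = <ᵇ-+ˡ a m n

-- The body of `orderIso` after zipping. A `Cell` here pairs a pattern letter, not a position, with
-- a value.
orderIsoPairs : List Cell → Bool
orderIsoPairs ps = allB (λ a → allB (λ b → eqB (proj₁ a <ᵇ proj₁ b) (proj₂ a <ᵇ proj₂ b)) ps) ps

orderIso-translate : ∀ a b τ s → orderIso τ (map (translate a b) s) ≡ orderIso τ s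
orderIso-translate a b τ s = begin
  orderIsoPairs (pairs τ (map proj₂ (map (translate a b) s)))
    ≡⟨ cong orderIsoPairs (trans (cong (pairs τ) (trans (sym (map-∘ s)) (map-∘ s)))
         (pairs-mapʳ (_+_ b) τ (map proj₂ s))) ⟩
  orderIsoPairs (map h ps)
    ≡⟨ trans (allB-map _ h ps) (allB-cong (λ x → trans (allB-map _ h ps)
         (allB-cong (λ y → cong (eqB (proj₁ x <ᵇ proj₁ y)) (<ᵇ-+ˡ b (proj₂ x) (proj₂ y))) ps)) ps) ⟩
  orderIsoPairs ps ∎
  where
  ps = pairs τ (map proj₂ s)
  h : Cell → Cell
  h (t , v) = t , b + v

adjOK-translate : ∀ a b ds s → adjOK ds (map (translate a b) s) ≡ adjOK ds s
adjOK-translate a b []           s                        = refl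
adjOK-translate a b (d ∷ ds)     []                       = refl
adjOK-translate a b (d ∷ ds)     (_ ∷ [])                 = refl
adjOK-translate a b (true ∷ ds)  (_ ∷ y ∷ s)              = adjOK-translate a b ds (y ∷ s)
adjOK-translate a b (false ∷ ds) ((i , _) ∷ (j , v) ∷ s) = cong₂ _∧_
  (trans (cong (a + j ≡ᵇ_) (sym (+-suc a i))) (≡ᵇ-+ˡ a j (suc i)))
  (adjOK-translate a b ds ((j , v) ∷ s))

-- Adjacency sees only differences of positions, and order isomorphism only comparisons of values.
-- So β may be indexed from any offset, and α raised.
isOccurrence-translate : ∀ a b p s → isOccurrence p (map (translate a b) s) ≡ isOccurrence p s
isOccurrence-translate a b p s = cong₂ _∧_ (sameLength-mapʳ _ (word p) s)
  (cong₂ _∧_ (adjOK-translate a b (dashes p) s) (orderIso-translate a b (word p) s))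

count-translate : ∀ p a b i xs →
  count (isOccurrence p) (indexed (a + i) (map (_+_ b) xs)) ≡ count (isOccurrence p) (indexed i xs)
count-translate p a b i xs = begin
  count (isOccurrence p) (indexed (a + i) (map (_+_ b) xs))
    ≡⟨ cong (count (isOccurrence p)) (indexed-translate a b i xs) ⟩
  count (isOccurrence p) (map (translate a b) (indexed i xs))
    ≡⟨ count-map (isOccurrence p) (translate a b) (indexed i xs) ⟩
  count (isOccurrence p ∘ map (translate a b)) (indexed i xs)
    ≡⟨ count-cong (isOccurrence-translate a b p) (indexed i xs) ⟩
  count (isOccurrence p) (indexed i xs) ∎

occurrences-shift : ∀ p j π → occurrences p (map (_+_ j) π) ≡ occurrences p π
occurrences-shift p j π = trans (occurrences-count p (map (_+_ j) π))
  (trans (count-translate p 0 j 0 π) (sym (occurrences-count p π)))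

count-indexed : ∀ p i π → count (isOccurrence p) (indexed i π) ≡ occurrences p π
count-indexed p i π = begin
  count (isOccurrence p) (indexed i π)
    ≡⟨ cong₂ (λ j xs → count (isOccurrence p) (indexed j xs)) (+-identityʳ i) (map-id π) ⟨
  count (isOccurrence p) (indexed (i + 0) (map (_+_ 0) π))
    ≡⟨ count-translate p i 0 0 π ⟩
  count (isOccurrence p) (indexed 0 π)
    ≡⟨ occurrences-count p π ⟨
  occurrences p π ∎

sameLength-∷ʳ : ∀ (w : List A) (c : A) (s : List B) (z : B) → sameLength (w ∷ʳ c) (s ∷ʳ z) ≡ sameLength w s
sameLength-∷ʳ []          c []          z = refl
sameLength-∷ʳ []          c (_ ∷ [])    z = refl
sameLength-∷ʳ []          c (_ ∷ _ ∷ _) z = refl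
sameLength-∷ʳ (_ ∷ [])    c []          z = refl
sameLength-∷ʳ (_ ∷ _ ∷ _) c []          z = refl
sameLength-∷ʳ (_ ∷ w)     c (_ ∷ s)     z = sameLength-∷ʳ w c s z

pairs-∷ʳ : ∀ (w : List A) (c : A) (s : List B) (z : B) → T (sameLength w s) →
  pairs (w ∷ʳ c) (s ∷ʳ z) ≡ pairs w s ∷ʳ (c , z)
pairs-∷ʳ []      c []      z t = refl
pairs-∷ʳ (x ∷ w) c (y ∷ s) z t = cong ((x , y) ∷_) (pairs-∷ʳ w c s z t)

orderIsoPairs-lookup : ∀ {ps a b} → T (orderIsoPairs ps) → a ∈ ps → b ∈ ps →
  T (eqB (proj₁ a <ᵇ proj₁ b) (proj₂ a <ᵇ proj₂ b))
orderIsoPairs-lookup {ps} t a∈ b∈ = allB-lookup {xs = ps} (allB-lookup {xs = ps} t a∈) b∈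

orderIsoPairs-< : ∀ {ps a b x y} → T (orderIsoPairs ps) → (a , x) ∈ ps → (b , y) ∈ ps → a < b → x < y
orderIsoPairs-< {ps} {a} {b} {x} {y} t a∈ b∈ a<b =
  <ᵇ⇒< x y (subst (λ e → T (eqB e (x <ᵇ y))) (<ᵇ-true a<b) (orderIsoPairs-lookup {ps} t a∈ b∈))

-- An occurrence of a word whose first letter is below its last one
-- cannot start at a value that is at least the one at which it ends.
¬occurrence-ends : ∀ p a w c → word p ≡ a ∷ w ∷ʳ c → a < c →
  ∀ x s {z : Cell} → proj₂ z ≤ proj₂ x → isOccurrence p (x ∷ s ∷ʳ z) ≡ false
¬occurrence-ends (gpat _ ds) a w c refl a<c x s {z} z≤x = ¬T⇒false λ t →
  let len , rest = T-∧⁻ t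
      iso = proj₂ (T-∧⁻ {adjOK ds (x ∷ s ∷ʳ z)} rest)
      len′ = subst T (trans (sameLength-∷ʳ (a ∷ w) c (x ∷ s) z) (sym (sameLength-mapʳ proj₂ w s))) len
      ps≡ = trans (cong (pairs (a ∷ w ∷ʳ c)) (map-++ proj₂ (x ∷ s) (z ∷ [])))
              (pairs-∷ʳ (a ∷ w) c (map proj₂ (x ∷ s)) (proj₂ z) len′)
  in ≤⇒≯ z≤x (orderIsoPairs-< {pairs (a ∷ w) (map proj₂ (x ∷ s)) ∷ʳ (c , proj₂ z)}
       (subst (T ∘ orderIsoPairs) ps≡ iso) (here refl)
       (∈-++⁺ʳ (pairs (a ∷ w) (map proj₂ (x ∷ s))) (here refl)) a<c)

-- Occurrences of the patterns

allB-All : ∀ {p : A → Bool} {xs} → T (allB p xs) → All (T ∘ p) xs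
allB-All {xs = []}     t = []
allB-All {xs = x ∷ xs} t = let px , pxs = T-∧⁻ t in px ∷ allB-All pxs

module _ {c z : ℕ} where
  private
    smaller : List Cell → Bool
    smaller = allB (λ a → proj₂ a <ᵇ z)

  -- As c exceeds all earlier pattern letters, every comparison with the new pair amounts to a value
  -- lying below z.
  orderIsoPairs-∷ʳ : ∀ {ps : List Cell} → All (λ a → proj₁ a < c) ps →
    orderIsoPairs (ps ∷ʳ (c , z)) ≡ orderIsoPairs ps ∧ allB (λ a → proj₂ a <ᵇ z) ps
  orderIsoPairs-∷ʳ {ps} ps<c = T-injective to from
    where
    to : T (orderIsoPairs (ps ∷ʳ (c , z))) → T (orderIsoPairs ps ∧ smaller ps)
    to t = T-∧⁺
      ( allB-tabulate {xs = ps} (λ a∈ → allB-tabulate {xs = ps} (λ b∈ →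
          orderIsoPairs-lookup {ps ∷ʳ (c , z)} t (∈-++⁺ˡ a∈) (∈-++⁺ˡ b∈)))
      , allB-tabulate {xs = ps} (λ a∈ → <⇒<ᵇ
          (orderIsoPairs-< {ps ∷ʳ (c , z)} t (∈-++⁺ˡ a∈) (∈-++⁺ʳ ps (here refl)) (All.lookup ps<c a∈))) )
    from : T (orderIsoPairs ps ∧ smaller ps) → T (orderIsoPairs (ps ∷ʳ (c , z)))
    from t = allB-tabulate {xs = ps ∷ʳ (c , z)} (λ a∈ → allB-tabulate {xs = ps ∷ʳ (c , z)} (λ b∈ →
        compare (∈-++⁻ ps a∈) (∈-++⁻ ps b∈)))
      where
      iso : T (orderIsoPairs ps)
      iso = proj₁ (T-∧⁻ {orderIsoPairs ps} t)
      ps<z : ∀ {a} → a ∈ ps → proj₂ a < z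
      ps<z a∈ = <ᵇ⇒< _ _ (allB-lookup {xs = ps} (proj₂ (T-∧⁻ {orderIsoPairs ps} t)) a∈)
      compare : ∀ {a b} → a ∈ ps ⊎ a ∈ (c , z) ∷ [] → b ∈ ps ⊎ b ∈ (c , z) ∷ [] →
        T (eqB (proj₁ a <ᵇ proj₁ b) (proj₂ a <ᵇ proj₂ b))
      compare (inj₁ a∈) (inj₁ b∈) = orderIsoPairs-lookup {ps} iso a∈ b∈
      compare (inj₁ a∈) (inj₂ (here refl))
        rewrite <ᵇ-true (All.lookup ps<c a∈) | <ᵇ-true (ps<z a∈) = tt
      compare (inj₂ (here refl)) (inj₁ b∈)
        rewrite <ᵇ-false (<⇒≤ (All.lookup ps<c b∈)) | <ᵇ-false (<⇒≤ (ps<z b∈)) = tt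
      compare (inj₂ (here refl)) (inj₂ (here refl))
        rewrite <ᵇ-false (≤-refl {c}) | <ᵇ-false (≤-refl {z}) = tt

pairs-All : ∀ {P : A → Set} {xs} → All P xs → ∀ (ys : List B) → All (P ∘ proj₁) (pairs xs ys)
pairs-All []         ys       = []
pairs-All (px ∷ pxs) []       = []
pairs-All (px ∷ pxs) (y ∷ ys) = px ∷ pairs-All pxs ys

allB-pairs : ∀ (q : B → Bool) (xs : List A) ys → T (sameLength xs ys) →
  allB (q ∘ proj₂) (pairs xs ys) ≡ allB q ys
allB-pairs q []       []       t = refl
allB-pairs q (x ∷ xs) (y ∷ ys) t = cong (q y ∧_) (allB-pairs q xs ys t)

orderIso-∷ʳ : ∀ {w c} s z → All (_< c) w → T (sameLength w s) →
  orderIso (w ∷ʳ c) (s ∷ʳ z) ≡ orderIso w s ∧ allB (λ v → proj₂ v <ᵇ proj₂ z) s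
orderIso-∷ʳ {w} {c} s z w<c t = begin
  orderIsoPairs (pairs (w ∷ʳ c) (map proj₂ (s ∷ʳ z)))
    ≡⟨ cong (orderIsoPairs ∘ pairs (w ∷ʳ c)) (map-++ proj₂ s (z ∷ [])) ⟩
  orderIsoPairs (pairs (w ∷ʳ c) (map proj₂ s ∷ʳ proj₂ z))
    ≡⟨ cong orderIsoPairs (pairs-∷ʳ w c (map proj₂ s) (proj₂ z) t′) ⟩
  orderIsoPairs (pairs w (map proj₂ s) ∷ʳ (c , proj₂ z))
    ≡⟨ orderIsoPairs-∷ʳ (pairs-All w<c (map proj₂ s)) ⟩
  orderIso w s ∧ allB (λ a → proj₂ a <ᵇ proj₂ z) (pairs w (map proj₂ s))
    ≡⟨ cong (orderIso w s ∧_) (trans (allB-pairs (_<ᵇ proj₂ z) w (map proj₂ s) t′)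
         (allB-map (_<ᵇ proj₂ z) proj₂ s)) ⟩
  orderIso w s ∧ allB (λ v → proj₂ v <ᵇ proj₂ z) s ∎
  where
  t′ : T (sameLength w (map proj₂ s))
  t′ = subst T (sym (sameLength-mapʳ proj₂ w s)) t

-- τ k has length k + 2, so that the descent pattern 21 is τ 0.
τ : ℕ → GPattern
τ k = p21-3-k (suc (suc k))

word-τ-suc : ∀ k → word (τ (suc k)) ≡ word (τ k) ∷ʳ (k + 3)
word-τ-suc k = cong (λ w → 2 ∷ 1 ∷ w)
  (trans (cong (map (λ i → i + 3)) (sym (upTo-∷ʳ k))) (map-++ (λ i → i + 3) (upTo k) (k ∷ [])))

word-τ-bound : ∀ k → All (_< k + 3) (word (τ k))
word-τ-bound zero    = s≤s (s≤s (s≤s z≤n)) ∷ s≤s (s≤s z≤n) ∷ []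
word-τ-bound (suc k) rewrite word-τ-suc k =
  All.∷ʳ⁺ (All.map m<n⇒m<1+n (word-τ-bound k)) ≤-refl

adjOK-dashes : ∀ m s → adjOK (replicate m true) s ≡ true
adjOK-dashes zero    s           = refl
adjOK-dashes (suc m) []          = refl
adjOK-dashes (suc m) (_ ∷ [])    = refl
adjOK-dashes (suc m) (_ ∷ y ∷ s) = adjOK-dashes m (y ∷ s)

below : Cell → List Cell → Bool
below z = allB (λ v → proj₂ v <ᵇ proj₂ z)

-- The additional letter k + 3 is the largest and follows a dash, so it contributes no adjacency
-- condition, only that z lies above everything before it.
isOccurrence-τ-∷ʳ : ∀ k s z →
  isOccurrence (τ (suc k)) (s ∷ʳ z) ≡ isOccurrence (τ k) s ∧ below z s
isOccurrence-τ-∷ʳ k []          z = refl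
isOccurrence-τ-∷ʳ k (_ ∷ [])    z = refl
isOccurrence-τ-∷ʳ k s@((i , _) ∷ (j , v) ∷ r) z =
  trans (cong₂ _∧_ len (cong₂ _∧_ adj refl)) (∧-guarded (sameLength (word (τ k)) s) (adjOK (dashes (τ k)) s) iso)
  where
  len : sameLength (word (τ (suc k))) (s ∷ʳ z) ≡ sameLength (word (τ k)) s
  len = trans (cong (λ w → sameLength w (s ∷ʳ z)) (word-τ-suc k))
          (sameLength-∷ʳ (word (τ k)) (k + 3) s z)
  adj : adjOK (dashes (τ (suc k))) (s ∷ʳ z) ≡ adjOK (dashes (τ k)) s
  adj = cong ((j ≡ᵇ suc i) ∧_)
    (trans (adjOK-dashes (suc k) ((j , v) ∷ r ∷ʳ z)) (sym (adjOK-dashes k ((j , v) ∷ r))))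
  iso : T (sameLength (word (τ k)) s) →
    orderIso (word (τ (suc k))) (s ∷ʳ z) ≡ orderIso (word (τ k)) s ∧ below z s
  iso t = trans (cong (λ w → orderIso w (s ∷ʳ z)) (word-τ-suc k)) (orderIso-∷ʳ s z (word-τ-bound k) t)
  -- `pairs` truncates, so the equation for `orderIso` holds only for equal lengths; for unequal
  -- ones the first conjunct makes both sides false.
  ∧-guarded : ∀ l a {o o′ b} → (T l → o′ ≡ o ∧ b) → l ∧ a ∧ o′ ≡ (l ∧ a ∧ o) ∧ b
  ∧-guarded false a f = refl
  ∧-guarded true  a f = trans (cong (a ∧_) (f tt)) (sym (∧-assoc a _ _))

count-τ-∷ʳ : ∀ k xs z → count (isOccurrence (τ (suc k))) (xs ∷ʳ z)
  ≡ count (isOccurrence (τ (suc k))) xs + count (λ s → isOccurrence (τ k) s ∧ below z s) xs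
count-τ-∷ʳ k xs z = trans (count-∷ʳ (isOccurrence (τ (suc k))) xs z)
  (cong (_+_ (count (isOccurrence (τ (suc k))) xs)) (count-cong (λ s → isOccurrence-τ-∷ʳ k s z) xs))

-- Dropping the last letter of an occurrence leaves one of τ k. The restriction `q` serves
-- `count-τ-two`, where the shorter occurrence must stay below a given letter to be extended by it.
restricted-τ-suc : ∀ k (q : Cell → Bool) xs →
  1 ≤ count (λ s → isOccurrence (τ (suc k)) s ∧ allB q s) xs →
  1 ≤ count (λ s → isOccurrence (τ k) s ∧ allB q s) xs
restricted-τ-suc k q xs = go (reverseView xs)
  where
  P : ℕ → List Cell → Bool
  P k s = isOccurrence (τ k) s ∧ allB q s
  P-∷ʳ : ∀ z s → T (P (suc k) (s ∷ʳ z)) → T (P k s)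
  P-∷ʳ z s t = let o , a = T-∧⁻ {isOccurrence (τ (suc k)) (s ∷ʳ z)} t
    in T-∧⁺ ( proj₁ (T-∧⁻ {isOccurrence (τ k) s} (subst T (isOccurrence-τ-∷ʳ k s z) o))
            , allB-tabulate {xs = s} (λ v∈ → allB-lookup {xs = s ∷ʳ z} a (∈-++⁺ˡ v∈)))
  go : ∀ {xs} → Reverse xs → 1 ≤ count (P (suc k)) xs → 1 ≤ count (P k) xs
  go []              ()
  go (xs ∶ rs ∶ʳ z) h = subst (1 ≤_) (sym (count-∷ʳ (P k) xs z)) (≤-trans here-or-before (m≤m+n _ _))
    where
    here-or-before : 1 ≤ count (P k) xs
    here-or-before with count (P (suc k)) xs in eq
    ... | suc _ = go rs (subst (1 ≤_) (sym eq) (s≤s z≤n))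
    ... | zero  = ≤-trans
      (subst (1 ≤_) (trans (count-∷ʳ (P (suc k)) xs z) (cong (_+ count (λ s → P (suc k) (s ∷ʳ z)) xs) eq)) h)
      (count-mono (P-∷ʳ z) xs)

private
  count-unrestricted : ∀ k xs →
    count (λ s → isOccurrence (τ k) s ∧ allB (const true) s) xs ≡ count (isOccurrence (τ k)) xs
  count-unrestricted k = count-cong (λ s → trans
    (cong (isOccurrence (τ k) s ∧_) (allB-true {xs = s} (All.universal (λ _ → refl) s))) (∧-identityʳ _))

count-τ-suc : ∀ k xs →
  1 ≤ count (isOccurrence (τ (suc k))) xs → 1 ≤ count (isOccurrence (τ k)) xs
count-τ-suc k xs h = subst (1 ≤_) (count-unrestricted k xs)
  (restricted-τ-suc k (const true) xs (subst (1 ≤_) (sym (count-unrestricted (suc k) xs)) h))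

-- An occurrence of τ (k + 2) restricts to two occurrences of τ (k + 1):
-- omit its last letter or its last but one.
count-τ-two : ∀ k xs →
  1 ≤ count (isOccurrence (τ (suc (suc k)))) xs → 2 ≤ count (isOccurrence (τ (suc k))) xs
count-τ-two k xs = go (reverseView xs)
  where
  O : ℕ → List Cell → Bool
  O k = isOccurrence (τ k)
  go : ∀ {xs} → Reverse xs → 1 ≤ count (O (suc (suc k))) xs → 2 ≤ count (O (suc k)) xs
  go [] ()
  go (xs ∶ rs ∶ʳ z) h rewrite count-τ-∷ʳ (suc k) xs z | count-τ-∷ʳ k xs z
    with count (O (suc (suc k))) xs in eq
  ... | suc _ = ≤-trans (go rs (subst (1 ≤_) (sym eq) (s≤s z≤n))) (m≤m+n _ _)
  ... | zero  = +-mono-≤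
    (≤-trans h (count-mono (λ s → proj₁ ∘ T-∧⁻ {O (suc k) s}) xs))
    (restricted-τ-suc k (λ v → proj₂ v <ᵇ proj₂ z) xs h)

occ : ℕ → List ℕ → ℕ
occ k = occurrences (τ k)

occ-suc-zero : ∀ k π → occ k π ≡ 0 → occ (suc k) π ≡ 0
occ-suc-zero k π e rewrite occurrences-count (τ k) π | occurrences-count (τ (suc k)) π =
  n<1⇒n≡0 (≰⇒> (λ h → contradiction (subst (1 ≤_) e (count-τ-suc k (indexed 0 π) h)) (λ ())))

occ-one⇒suc-zero : ∀ k π → occ (suc k) π ≡ 1 → occ (suc (suc k)) π ≡ 0
occ-one⇒suc-zero k π e rewrite occurrences-count (τ (suc k)) π | occurrences-count (τ (suc (suc k))) π =
  n<1⇒n≡0 (≰⇒> (λ h → contradiction (subst (2 ≤_) e (count-τ-two k (indexed 0 π) h)) (λ {(s≤s ())})))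

dominates⇒All : ∀ {α β} → dominates α β ≡ true → All (λ a → All (_≤ a) β) α
dominates⇒All {α} {β} e = All.map (λ {a} t → All.map (λ {b} nlt → ≮⇒≥ (λ a<b →
    subst (T ∘ not) (<ᵇ-true a<b) nlt)) (allB-All {xs = β} t))
  (allB-All {xs = α} (subst T (sym e) tt))

-- No occurrence crosses the cut after the maximum x.
occurrences-node : ∀ p a w c → word p ≡ a ∷ w ∷ʳ c → a < c → ∀ {x α β} →
  All (_< x) β → dominates α β ≡ true →
  occurrences p (α ++ x ∷ β) ≡ count (isOccurrence p) (indexed 0 α ∷ʳ (length α , x)) + occurrences p β
occurrences-node p@(gpat _ _) a w c refl a<c {x} {α} {β} β<x dom = begin
  occurrences p (α ++ x ∷ β)
    ≡⟨ occurrences-count p (α ++ x ∷ β) ⟩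
  count (isOccurrence p) (indexed 0 (α ++ x ∷ β))
    ≡⟨ cong (count (isOccurrence p)) (trans (indexed-++ 0 α (x ∷ β)) (sym (++-assoc (indexed 0 α) _ _))) ⟩
  count (isOccurrence p) ((indexed 0 α ∷ʳ (length α , x)) ++ indexed (suc (length α)) β)
    ≡⟨ count-++ {R = λ u v → proj₂ v ≤ proj₂ u} refl (λ u s → ¬occurrence-ends p a w c refl a<c u s)
         (All.∷ʳ⁺ (All.map indexed-All (indexed-All (dominates⇒All {α} dom)))
           (indexed-All (All.map <⇒≤ β<x))) ⟩
  count (isOccurrence p) (indexed 0 α ∷ʳ (length α , x)) + count (isOccurrence p) (indexed (suc (length α)) β)
    ≡⟨ cong (_+_ (count (isOccurrence p) (indexed 0 α ∷ʳ (length α , x)))) (count-indexed p (suc (length α)) β) ⟩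
  count (isOccurrence p) (indexed 0 α ∷ʳ (length α , x)) + occurrences p β ∎

occ-suc-node : ∀ k {x α β} → All (_< x) α → All (_< x) β → dominates α β ≡ true →
  occ (suc k) (α ++ x ∷ β) ≡ occ (suc k) α + occ k α + occ (suc k) β
occ-suc-node k {x} {α} {β} α<x β<x dom = begin
  occ (suc k) (α ++ x ∷ β)
    ≡⟨ occurrences-node (τ (suc k)) 2 (1 ∷ map (_+ 3) (upTo k)) (k + 3) (word-τ-suc k) (m≤n+m 3 k)
         {α = α} β<x dom ⟩
  count (isOccurrence (τ (suc k))) (indexed 0 α ∷ʳ z) + occ (suc k) β
    ≡⟨ cong (_+ occ (suc k) β) (begin
         count (isOccurrence (τ (suc k))) (indexed 0 α ∷ʳ z)
           ≡⟨ count-τ-∷ʳ k (indexed 0 α) z ⟩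
         count (isOccurrence (τ (suc k))) (indexed 0 α) + count (λ s → isOccurrence (τ k) s ∧ below z s) (indexed 0 α)
           ≡⟨ cong₂ _+_ (sym (occurrences-count (τ (suc k)) α))
                (trans (count-congAll {R = λ v → proj₂ v < x} drop-below (indexed-All α<x))
                  (sym (occurrences-count (τ k) α))) ⟩
         occ (suc k) α + occ k α ∎) ⟩
  occ (suc k) α + occ k α + occ (suc k) β ∎
  where
  z : Cell
  z = length α , x
  drop-below : ∀ {s} → All (λ v → proj₂ v < x) s → isOccurrence (τ k) s ∧ below z s ≡ isOccurrence (τ k) s
  drop-below {s} s<x = trans (cong (isOccurrence (τ k) s ∧_) (allB-true (All.map <ᵇ-true s<x))) (∧-identityʳ _)

-- Avoidance of 1-3-2 at the maximum

av : List ℕ → Bool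
av π = occurrences p1-3-2 π ≡ᵇ 0

132-occurrence : ∀ {i j l a x b} → a < b → b < x →
  isOccurrence p1-3-2 ((i , a) ∷ (j , x) ∷ (l , b) ∷ []) ≡ true
132-occurrence {a = a} {x} {b} a<b b<x
  rewrite <ᵇ-true a<b | <ᵇ-true b<x | <ᵇ-true (<-trans a<b b<x)
        | <ᵇ-false (<⇒≤ a<b) | <ᵇ-false (<⇒≤ b<x) | <ᵇ-false (<⇒≤ (<-trans a<b b<x))
        | <ᵇ-false (≤-refl {a}) | <ᵇ-false (≤-refl {b}) | <ᵇ-false (≤-refl {x}) = refl

132-not-ending-in-maximum : ∀ {s} {z : Cell} → All (λ v → proj₂ v < proj₂ z) s →
  isOccurrence p1-3-2 (s ∷ʳ z) ≡ false
132-not-ending-in-maximum []                    = refl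
132-not-ending-in-maximum (_ ∷ [])              = refl
132-not-ending-in-maximum (_ ∷ _ ∷ _ ∷ [])      = refl
132-not-ending-in-maximum (_ ∷ _ ∷ _ ∷ _ ∷ _)   = refl
-- The only fitting length: y and z play 3 and 2, which would force z < y.
132-not-ending-in-maximum {x ∷ y ∷ []} {z} (_ ∷ y<z ∷ []) = ¬T⇒false λ t →
  <-asym y<z (orderIsoPairs-< {(1 , proj₂ x) ∷ (3 , proj₂ y) ∷ (2 , proj₂ z) ∷ []} {2} {3}
    t (there (there (here refl))) (there (here refl)) ≤-refl)

occurrences-132-node : ∀ {x α β} → All (_< x) α → All (_< x) β → dominates α β ≡ true →
  occurrences p1-3-2 (α ++ x ∷ β) ≡ occurrences p1-3-2 α + occurrences p1-3-2 β
occurrences-132-node {x} {α} {β} α<x β<x dom = begin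
  occurrences p1-3-2 (α ++ x ∷ β)
    ≡⟨ occurrences-node p1-3-2 1 (3 ∷ []) 2 refl ≤-refl {α = α} β<x dom ⟩
  count P (indexed 0 α ∷ʳ z) + occurrences p1-3-2 β
    ≡⟨ cong (_+ occurrences p1-3-2 β) (begin
         count P (indexed 0 α ∷ʳ z)
           ≡⟨ count-∷ʳ P (indexed 0 α) z ⟩
         count P (indexed 0 α) + count (λ s → P (s ∷ʳ z)) (indexed 0 α)
           ≡⟨ cong₂ _+_ (sym (occurrences-count p1-3-2 α))
                (trans (count-congAll 132-not-ending-in-maximum (indexed-All α<x)) (count-false (indexed 0 α))) ⟩
         occurrences p1-3-2 α + 0
           ≡⟨ +-identityʳ _ ⟩
         occurrences p1-3-2 α ∎) ⟩
  occurrences p1-3-2 α + occurrences p1-3-2 β ∎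
  where
  P = isOccurrence p1-3-2
  z : Cell
  z = length α , x

-- Where dominance fails there are a in α and b in β with a < b < x, and a, x, b is the occurrence.
132-across-maximum : ∀ {x α β} → All (_< x) β → dominates α β ≡ false →
  1 ≤ occurrences p1-3-2 (α ++ x ∷ β)
132-across-maximum {x} {α} {β} β<x dom
  with a , a∈ , row ← allB-false α dom
  with b , b∈ , ab ← allB-false β row
  with i , i∈ ← indexed-∈ 0 a∈
  with l , l∈ ← indexed-∈ (suc (length α)) b∈ =
  subst (1 ≤_) (sym (trans (occurrences-count p1-3-2 (α ++ x ∷ β))
                      (cong (count (isOccurrence p1-3-2)) (indexed-++ 0 α (x ∷ β)))))
    (count-⊆ {s = (i , a) ∷ (length α , x) ∷ (l , b) ∷ []} (++⁺ (from∈ i∈) (refl ∷ from∈ l∈))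
      (subst T (sym (132-occurrence {i} {length α} {l} a<b (All.lookup β<x b∈))) tt))
  where
  a<b = <ᵇ⇒< a b (subst T (sym (not-injective {a <ᵇ b} {true} ab)) tt)

≡ᵇ0-+ : ∀ m n → (m + n ≡ᵇ 0) ≡ (m ≡ᵇ 0) ∧ (n ≡ᵇ 0)
≡ᵇ0-+ zero    n = refl
≡ᵇ0-+ (suc m) n = refl

av-node : ∀ {x α β} → All (_< x) α → All (_< x) β →
  av (α ++ x ∷ β) ≡ dominates α β ∧ av α ∧ av β
av-node {x} {α} {β} α<x β<x with dominates α β in dom
... | true  = trans (cong (_≡ᵇ 0) (occurrences-132-node {α = α} α<x β<x dom))
                (≡ᵇ0-+ (occurrences p1-3-2 α) (occurrences p1-3-2 β))
... | false with occurrences p1-3-2 (α ++ x ∷ β) | 132-across-maximum {α = α} β<x dom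
...   | suc _ | _ = refl

-- Descents, the base pattern 21

topDescent : ℕ → List ℕ → ℕ
topDescent x []      = 0
topDescent x (y ∷ _) = ⟦ y <ᵇ x ⟧

descents : List ℕ → ℕ
descents []       = 0
descents (x ∷ xs) = topDescent x xs + descents xs

count-single : ∀ {A : Set} {P : List A → Bool} → (∀ x s → P (x ∷ s) ≡ false) →
  ∀ xs → count P xs ≡ ⟦ P [] ⟧
count-single {P = P} P-false []       = +-identityʳ _
count-single {P = P} P-false (x ∷ xs) = trans (count-∷ P x xs)
  (cong₂ _+_ (trans (count-cong (P-false x) xs) (count-false xs)) (count-single P-false xs))

orderIso-21 : ∀ i j x y → orderIso (2 ∷ 1 ∷ []) ((i , x) ∷ (j , y) ∷ []) ≡ (y <ᵇ x)
orderIso-21 i j x y with <-cmp x y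
... | tri< x<y _ _ rewrite <ᵇ-true x<y | <ᵇ-false (<⇒≤ x<y) | <ᵇ-false (≤-refl {x}) = refl
... | tri≈ _ refl _ rewrite <ᵇ-false (≤-refl {x}) = refl
... | tri> _ _ y<x rewrite <ᵇ-true y<x | <ᵇ-false (<⇒≤ y<x) | <ᵇ-false (≤-refl {x}) | <ᵇ-false (≤-refl {y}) = refl

indexed-≥ : ∀ i xs → All (λ c → i ≤ proj₁ c) (indexed i xs)
indexed-≥ i []       = []
indexed-≥ i (x ∷ xs) = ≤-refl ∷ All.map (≤-trans (n≤1+n i)) (indexed-≥ (suc i) xs)

-- `occurrences-node` requires a first letter below the last, which 21 violates. Descents have a
-- recursion along the word that gives the effect of the maximum directly.
occ-0 : ∀ π → occ 0 π ≡ descents π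
occ-0 π = trans (occurrences-count (τ 0) π) (go 0 π)
  where
  P = isOccurrence (τ 0)
  from : ∀ i x xs → count (P ∘ ((i , x) ∷_)) (indexed (suc i) xs) ≡ topDescent x xs
  from i x []       = refl
  from i x (y ∷ ys) = begin
    count Q ((suc i , y) ∷ rest)
      ≡⟨ count-∷ Q (suc i , y) rest ⟩
    count (Q ∘ ((suc i , y) ∷_)) rest + count Q rest
      ≡⟨ cong₂ _+_ (count-single (λ _ _ → refl) rest)
           (trans (count-congAll distant (indexed-≥ (suc (suc i)) ys)) (count-false rest)) ⟩
    ⟦ P ((i , x) ∷ (suc i , y) ∷ []) ⟧ + 0
      ≡⟨ +-identityʳ _ ⟩
    ⟦ P ((i , x) ∷ (suc i , y) ∷ []) ⟧
      ≡⟨ cong ⟦_⟧ (cong₂ _∧_ (cong (_∧ true) (i≡ᵇi i)) (orderIso-21 i (suc i) x y)) ⟩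
    ⟦ y <ᵇ x ⟧ ∎
    where
    Q    = P ∘ ((i , x) ∷_)
    rest = indexed (suc (suc i)) ys
    i≡ᵇi : ∀ i → (i ≡ᵇ i) ≡ true
    i≡ᵇi zero    = refl
    i≡ᵇi (suc i) = i≡ᵇi i
    -- A second letter beyond position i + 1 breaks the adjacency of 21; any other length is wrong.
    distant : ∀ {s} → All (λ c → suc (suc i) ≤ proj₁ c) s → Q s ≡ false
    distant []          = refl
    distant (_ ∷ _ ∷ _) = refl
    distant {(j , _) ∷ []} (i<j ∷ []) = ¬T⇒false λ t →
      let j≡ = ≡ᵇ⇒≡ j (suc i) (proj₁ (T-∧⁻ (proj₁ (T-∧⁻ {(j ≡ᵇ suc i) ∧ true} t))))
      in <-irrefl (sym j≡) i<j
  go : ∀ i π → count P (indexed i π) ≡ descents π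
  go i []       = refl
  go i (x ∷ xs) = trans (count-∷ P (i , x) (indexed (suc i) xs)) (cong₂ _+_ (from i x xs) (go (suc i) xs))

descents-node : ∀ {x α β} → All (_< x) α → All (_< x) β →
  descents (α ++ x ∷ β) ≡ descents α + (⟦ not (null β) ⟧ + descents β)
descents-node []                        []        = refl
descents-node []                        (b<x ∷ _) rewrite <ᵇ-true b<x = refl
descents-node {α = a ∷ []}    (a<x ∷ []) β<x rewrite <ᵇ-false (<⇒≤ a<x) = descents-node [] β<x
descents-node {α = a ∷ a′ ∷ α} (_ ∷ α<x)  β<x =
  trans (cong (_+_ ⟦ a′ <ᵇ a ⟧) (descents-node α<x β<x)) (sym (+-assoc ⟦ a′ <ᵇ a ⟧ _ _))

occ-zero-node : ∀ {x α β} → All (_< x) α → All (_< x) β →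
  occ 0 (α ++ x ∷ β) ≡ occ 0 α + (⟦ not (null β) ⟧ + occ 0 β)
occ-zero-node {x} {α} {β} α<x β<x
  rewrite occ-0 (α ++ x ∷ β) | occ-0 α | occ-0 β = descents-node α<x β<x

-- Generating functions

avoiding : ℕ → List ℕ → ℕ
avoiding k π = ⟦ av π ∧ (occ k π ≡ᵇ 0) ⟧

-- For k ≥ 1 the last condition follows from the others; for k = 0 it makes
-- the recurrence once-suc-node hold for all k.
once : ℕ → List ℕ → ℕ
once k π = ⟦ av π ∧ (occ k π ≡ᵇ 1) ∧ (occ (suc k) π ≡ᵇ 0) ⟧

empty : List ℕ → ℕ
empty π = ⟦ null π ⟧

-- Its series `E` is F 0 - 1, counted directly so that no subtraction occurs.
avoidingNonempty : List ℕ → ℕ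
avoidingNonempty π = ⟦ (av π ∧ (occ 0 π ≡ᵇ 0)) ∧ not (null π) ⟧

-- `av-node` supplies the dominance factor, so `P` has to be evaluated only where dominance holds.
node-weight : ∀ {x α β} (P : List ℕ → Bool) {c w} → All (_< x) α → All (_< x) β →
  (dominates α β ≡ true → P (α ++ x ∷ β) ≡ c) → ⟦ (av α ∧ av β) ∧ c ⟧ ≡ w →
  ⟦ av (α ++ x ∷ β) ∧ P (α ++ x ∷ β) ⟧ ≡ ⟦ dominates α β ⟧ * w
node-weight {x} {α} {β} P {c} {w} α<x β<x P≡ c≡w
  rewrite av-node {x} {α} {β} α<x β<x with dominates α β
... | true  = trans (trans (cong (λ b → ⟦ (av α ∧ av β) ∧ b ⟧) (P≡ refl)) c≡w) (sym (+-identityʳ w))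
... | false = refl

≡ᵇ0-+suc : ∀ m n → (m + suc n ≡ᵇ 0) ≡ false
≡ᵇ0-+suc m n rewrite +-suc m n = refl

⟦∧false⟧ : ∀ a → ⟦ a ∧ false ⟧ ≡ 0
⟦∧false⟧ a = cong ⟦_⟧ (∧-zeroʳ a)

-- A nonempty β creates a descent from x, so β must be empty. The factor `empty β` keeps the product
-- form that `genFun-suc` expects.
avoiding-zero-node : ∀ {x α β} → All (_< x) α → All (_< x) β →
  avoiding 0 (α ++ x ∷ β) ≡ ⟦ dominates α β ⟧ * (avoiding 0 α * empty β)
avoiding-zero-node {x} {α} {β} α<x β<x =
  node-weight (λ π → occ 0 π ≡ᵇ 0) α<x β<x (λ _ → cong (_≡ᵇ 0) (occ-zero-node α<x β<x)) (weight β)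
  where
  weight : ∀ β → ⟦ (av α ∧ av β) ∧ (occ 0 α + (⟦ not (null β) ⟧ + occ 0 β) ≡ᵇ 0) ⟧ ≡ avoiding 0 α * empty β
  weight []      rewrite ∧-identityʳ (av α) | +-identityʳ (occ 0 α) = sym (*-identityʳ _)
  weight (b ∷ β) rewrite ≡ᵇ0-+suc (occ 0 α) (occ 0 (b ∷ β)) =
    trans (⟦∧false⟧ (av α ∧ av (b ∷ β))) (sym (*-zeroʳ (avoiding 0 α)))

avoiding-suc-node : ∀ k {x α β} → All (_< x) α → All (_< x) β →
  avoiding (suc k) (α ++ x ∷ β) ≡ ⟦ dominates α β ⟧ * (avoiding k α * avoiding (suc k) β)
avoiding-suc-node k {x} {α} {β} α<x β<x =
  node-weight (λ π → occ (suc k) π ≡ᵇ 0) α<x β<x (cong (_≡ᵇ 0) ∘ occ-suc-node k {x} {α} α<x β<x)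
    (weight (av α) (av β) (occ (suc k) α) (occ k α) (occ (suc k) β) (occ-suc-zero k α))
  where
  weight : ∀ a b m n l → (n ≡ 0 → m ≡ 0) →
    ⟦ (a ∧ b) ∧ (m + n + l ≡ᵇ 0) ⟧ ≡ ⟦ a ∧ (n ≡ᵇ 0) ⟧ * ⟦ b ∧ (l ≡ᵇ 0) ⟧
  weight false b     m n       l n⇒m = refl
  weight true  b     m zero    l n⇒m rewrite n⇒m refl = sym (+-identityʳ _)
  weight true  b     m (suc n) l n⇒m rewrite +-suc m n = ⟦∧false⟧ b

-- A descent in α would extend by x to a τ 1. Hence α has none, and the single descent leads from x
-- into β, which is nonempty and has no descent itself.
once-zero-node : ∀ {x α β} → All (_< x) α → All (_< x) β →
  once 0 (α ++ x ∷ β) ≡ ⟦ dominates α β ⟧ * (avoiding 0 α * avoidingNonempty β)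
once-zero-node {x} {α} {β} α<x β<x =
  node-weight (λ π → (occ 0 π ≡ᵇ 1) ∧ (occ 1 π ≡ᵇ 0)) α<x β<x
    (λ dom → cong₂ (λ i j → (i ≡ᵇ 1) ∧ (j ≡ᵇ 0)) (occ-zero-node α<x β<x) (occ-suc-node 0 {x} {α} α<x β<x dom))
    (weight (av α) (occ 0 α) (occ 1 α) β (occ-suc-zero 0 α) (occ-suc-zero 0 β))
  where
  weight : ∀ a n p β → (n ≡ 0 → p ≡ 0) → (occ 0 β ≡ 0 → occ 1 β ≡ 0) →
    ⟦ (a ∧ av β) ∧ (n + (⟦ not (null β) ⟧ + occ 0 β) ≡ᵇ 1) ∧ (p + n + occ 1 β ≡ᵇ 0) ⟧
      ≡ ⟦ a ∧ (n ≡ᵇ 0) ⟧ * avoidingNonempty β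
  weight false n       p β       n⇒p l⇒q = refl
  weight true  (suc n) p β       n⇒p l⇒q rewrite +-suc p n =
    trans (cong (λ c → ⟦ av β ∧ c ⟧) (∧-zeroʳ _)) (⟦∧false⟧ (av β))
  weight true  zero    p []      n⇒p l⇒q = refl
  weight true  zero    p (b ∷ β) n⇒p l⇒q rewrite n⇒p refl with occ 0 (b ∷ β)
  ... | zero  rewrite l⇒q refl = trans (cong ⟦_⟧ (sym (∧-identityʳ _))) (sym (+-identityʳ _))
  ... | suc l = trans (⟦∧false⟧ (av (b ∷ β)))
                  (cong (λ c → ⟦ c ∧ true ⟧ + 0) (sym (∧-zeroʳ (av (b ∷ β)))))

-- Excluding τ (k+2) forces m = 0 for the number m of τ (k+1) in α. The two summands distinguish
-- whether the single τ (k+1) is a τ k of α followed by x, or lies in β.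
once-suc-node : ∀ k {x α β} → All (_< x) α → All (_< x) β →
  once (suc k) (α ++ x ∷ β)
    ≡ ⟦ dominates α β ⟧ * (once k α * avoiding (suc k) β + avoiding k α * once (suc k) β)
once-suc-node k {x} {α} {β} α<x β<x =
  node-weight (λ π → (occ (suc k) π ≡ᵇ 1) ∧ (occ (suc (suc k)) π ≡ᵇ 0)) α<x β<x
    (λ dom → cong₂ (λ i j → (i ≡ᵇ 1) ∧ (j ≡ᵇ 0))
      (occ-suc-node k {x} {α} α<x β<x dom) (occ-suc-node (suc k) {x} {α} α<x β<x dom))
    (weight (av α) (av β) (occ (suc k) α) (occ k α) (occ (suc k) β) (occ (suc (suc k)) α)
      (occ (suc (suc k)) β) (occ-suc-zero k α) (occ-suc-zero (suc k) α) (occ-suc-zero (suc k) β))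
  where
  weight : ∀ a b m n l p q → (n ≡ 0 → m ≡ 0) → (m ≡ 0 → p ≡ 0) → (l ≡ 0 → q ≡ 0) →
    ⟦ (a ∧ b) ∧ (m + n + l ≡ᵇ 1) ∧ (p + m + q ≡ᵇ 0) ⟧
      ≡ ⟦ a ∧ (n ≡ᵇ 1) ∧ (m ≡ᵇ 0) ⟧ * ⟦ b ∧ (l ≡ᵇ 0) ⟧
        + ⟦ a ∧ (n ≡ᵇ 0) ⟧ * ⟦ b ∧ (l ≡ᵇ 1) ∧ (q ≡ᵇ 0) ⟧
  weight false b m n l p q n⇒m m⇒p l⇒q = refl
  weight true false m n l p q n⇒m m⇒p l⇒q =
    sym (cong₂ _+_ (*-zeroʳ ⟦ (n ≡ᵇ 1) ∧ (m ≡ᵇ 0) ⟧) (*-zeroʳ ⟦ n ≡ᵇ 0 ⟧))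
  weight true true (suc m) zero    l p q n⇒m m⇒p l⇒q = contradiction (n⇒m refl) λ ()
  weight true true (suc m) (suc n) l p q n⇒m m⇒p l⇒q
    rewrite +-suc p m | ∧-zeroʳ (m + suc n + l ≡ᵇ 0) | ∧-zeroʳ (n ≡ᵇ 0) = refl
  weight true true zero n l p q n⇒m m⇒p l⇒q rewrite m⇒p refl with n
  ... | zero        = sym (+-identityʳ _)
  ... | suc (suc _) = refl
  ... | suc zero    with l
  ...   | zero  rewrite l⇒q refl = refl
  ...   | suc _ = refl

avoiding-shift : ∀ k j σ → avoiding k (map (_+_ j) σ) ≡ avoiding k σ
avoiding-shift k j σ
  rewrite occurrences-shift p1-3-2 j σ | occurrences-shift (τ k) j σ = refl

once-shift : ∀ k j σ → once k (map (_+_ j) σ) ≡ once k σ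
once-shift k j σ
  rewrite occurrences-shift p1-3-2 j σ | occurrences-shift (τ k) j σ
        | occurrences-shift (τ (suc k)) j σ = refl

genFun-suc : ∀ {W U V : List ℕ → ℕ} → (∀ j σ → U (map (_+_ j) σ) ≡ U σ) →
  (∀ {x α β} → All (_< x) α → All (_< x) β → W (α ++ x ∷ β) ≡ ⟦ dominates α β ⟧ * (U α * V β)) →
  ∀ n → genFun W (suc n) ≡ (genFun U ⊛ genFun V) n
genFun-suc {W} {U} {V} U-shift W-node n =
  trans (cong +_ (∑-S-suc W (λ α β → U α * V β) W-node n)) (convolution-⊛ U V U-shift n)

module Ser = CommutativeRing seriesRing

-- This series acts as F (-1) = V 0 / V 1 = 1, which makes `F-zero` the instance k = -1 of `F-suc`.
empty-genFun : genFun empty ≗ 𝟙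
empty-genFun zero    = refl
empty-genFun (suc n) = cong +_ (begin
  ∑ empty (S (suc n))               ≡⟨ ∑-concatMap empty (inserts (suc n)) (S n) ⟩
  ∑ (∑ empty ∘ inserts (suc n)) (S n) ≡⟨ ∑-cong nonempty (S n) ⟩
  ∑ (λ _ → 0) (S n)                 ≡⟨ ∑-zero (S n) ⟩
  0                                 ∎)
  where
  nonempty : ∀ π → ∑ empty (inserts (suc n) π) ≡ 0
  nonempty []      = refl
  nonempty (y ∷ π) = trans (∑-map empty (y ∷_) (inserts (suc n) π)) (∑-zero (inserts (suc n) π))

zero-plus : ∀ {a b} → a 0 ≡ + 0 → (∀ n → a (suc n) ≡ b n) → a ≗ X ⊛ b
zero-plus {b = b} a₀ aₛ zero    = trans a₀ (sym (ℤ.*-zeroˡ (b 0)))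
zero-plus {b = b} a₀ aₛ (suc n) = trans (aₛ n) (sym (X⊛-suc b n))

one-plus : ∀ {a b} → a 0 ≡ + 1 → (∀ n → a (suc n) ≡ b n) → a ≗ 𝟙 ⊞ X ⊛ b
one-plus {b = b} a₀ aₛ zero    = trans a₀ (cong (ℤ._+_ (+ 1)) (sym (ℤ.*-zeroˡ (b 0))))
one-plus {b = b} a₀ aₛ (suc n) = trans (aₛ n) (sym (trans (ℤ.+-identityˡ _) (X⊛-suc b n)))

-- Functional equations and Chebyshev denominators

F H v : ℕ → Series
F k = genFun (avoiding k)
H k = genFun (once k)
v k = coeff (V k)

E : Series
E = genFun avoidingNonempty

F-zero : F 0 ≗ 𝟙 ⊞ X ⊛ (genFun empty ⊛ F 0)
F-zero = one-plus refl λ n → trans (genFun-suc (avoiding-shift 0) avoiding-zero-node n)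
  (⊛-comm (F 0) (genFun empty) n)

F-suc : ∀ k → F (suc k) ≗ 𝟙 ⊞ X ⊛ (F k ⊛ F (suc k))
F-suc k = one-plus refl (genFun-suc (avoiding-shift k) (avoiding-suc-node k))

H-zero : H 0 ≗ X ⊛ (F 0 ⊛ E)
H-zero = zero-plus refl (genFun-suc (avoiding-shift 0) once-zero-node)

H-suc : ∀ k → H (suc k) ≗ X ⊛ (H k ⊛ F (suc k) ⊞ F k ⊛ H (suc k))
H-suc k = zero-plus refl λ n → begin
  + ∑ (once (suc k)) (S (suc n))
    ≡⟨ cong +_ (trans (∑-S-suc (once (suc k)) (λ α β → u α β + w α β) (once-suc-node k) n)
         (convolution-+ 0 n u w)) ⟩
  + (convolution 0 n u + convolution 0 n w)
    ≡⟨ ℤ.pos-+ (convolution 0 n u) (convolution 0 n w) ⟩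
  + convolution 0 n u ℤ.+ + convolution 0 n w
    ≡⟨ cong₂ ℤ._+_ (convolution-⊛ (once k) (avoiding (suc k)) (once-shift k) n)
         (convolution-⊛ (avoiding k) (once (suc k)) (avoiding-shift k) n) ⟩
  (H k ⊛ F (suc k) ⊞ F k ⊛ H (suc k)) n ∎
  where
  u w : List ℕ → List ℕ → ℕ
  u α β = once k α * avoiding (suc k) β
  w α β = avoiding k α * once (suc k) β

F-zero-split : F 0 ≗ E ⊞ 𝟙
F-zero-split n = trans (cong +_ (trans (∑-cong split (S n)) (∑-+ avoidingNonempty empty (S n))))
  (trans (ℤ.pos-+ (∑ avoidingNonempty (S n)) _) (cong (ℤ._+_ (E n)) (empty-genFun n)))
  where
  split : ∀ π → avoiding 0 π ≡ avoidingNonempty π + empty π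
  split []      = refl
  split (a ∷ π) = trans (cong ⟦_⟧ (sym (∧-identityʳ _))) (sym (+-identityʳ _))

v-step : ∀ k → v (suc (suc k)) ⊞ X ⊛ v k ≗ v (suc k)
v-step k n = begin
  v (suc (suc k)) n ℤ.+ (X ⊛ v k) n
    ≡⟨ cong (ℤ._+ (X ⊛ v k) n) (coeff-⊕ (V (suc k)) (+ 0 ∷ scale (ℤ.- (+ 1)) (V k)) n) ⟩
  v (suc k) n ℤ.+ coeff (+ 0 ∷ scale (ℤ.- (+ 1)) (V k)) n ℤ.+ (X ⊛ v k) n
    ≡⟨ ℤ.+-assoc (v (suc k) n) _ _ ⟩
  v (suc k) n ℤ.+ (coeff (+ 0 ∷ scale (ℤ.- (+ 1)) (V k)) n ℤ.+ (X ⊛ v k) n)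
    ≡⟨ cong (ℤ._+_ (v (suc k) n)) (cancel n) ⟩
  v (suc k) n ℤ.+ + 0
    ≡⟨ ℤ.+-identityʳ _ ⟩
  v (suc k) n ∎
  where
  cancel : ∀ n → coeff (+ 0 ∷ scale (ℤ.- (+ 1)) (V k)) n ℤ.+ (X ⊛ v k) n ≡ + 0
  cancel zero    = trans (ℤ.+-identityˡ _) (ℤ.*-zeroˡ (v k 0))
  cancel (suc n) = trans
    (cong₂ ℤ._+_ (trans (coeff-scale (ℤ.- (+ 1)) (V k) n) (ℤ.-1*i≡-i (v k n))) (X⊛-suc (v k) n))
    (ℤ.+-inverseˡ (v k n))

v₁≗𝟙 : v 1 ≗ 𝟙
v₁≗𝟙 zero    = refl
v₁≗𝟙 (suc n) = refl

open RationalRecurrences seriesRing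

F⊛v : ∀ k → F k ⊛ v (suc (suc k)) ≗ v (suc k)
F⊛v zero    = avoid-step (v-step 0) (Ser.trans (Ser.*-congʳ empty-genFun) (Ser.*-identityˡ (v 1))) F-zero
F⊛v (suc k) = avoid-step (v-step (suc k)) (F⊛v k) (F-suc k)

X^ : ℕ → Series
X^ zero    = 𝟙
X^ (suc k) = X ⊛ X^ k

X^-coeff : ∀ k n → X^ k n ≡ (if n ≡ᵇ k then + 1 else + 0)
X^-coeff zero    zero    = refl
X^-coeff zero    (suc n) = refl
X^-coeff (suc k) zero    = ℤ.*-zeroˡ (X^ k 0)
X^-coeff (suc k) (suc n) = trans (X⊛-suc (X^ k) n) (X^-coeff k n)

H⊛v² : ∀ k → H k ⊛ (v (suc (suc k)) ⊛ v (suc (suc k))) ≗ X^ (suc (suc k))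
H⊛v² zero    = Ser.trans
  (once-base v₂⊞X≗𝟙 (Ser.trans (F⊛v 0) v₁≗𝟙) F-zero-split H-zero)
  (Ser.*-congˡ (Ser.sym (Ser.*-identityʳ X)))
  where
  v₂⊞X≗𝟙 : v 2 ⊞ X ≗ 𝟙
  v₂⊞X≗𝟙 = Ser.trans (Ser.+-congˡ {v 2} (Ser.sym (Ser.trans (Ser.*-congˡ v₁≗𝟙) (Ser.*-identityʳ X))))
              (Ser.trans (v-step 0) v₁≗𝟙)
H⊛v² (suc k) = once-step (v-step (suc k)) (F⊛v k) (F⊛v (suc k)) (H⊛v² k) (H-suc k)

-- The index `suc k` matters: 213 has one descent and avoids 1-3-2, yet contains τ 1, so the
-- equality would fail for τ 0.
g-once : ∀ k n → g (τ (suc k)) n ≡ ∑ (once (suc k)) (S n)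
g-once k n = trans
  (length-filter (λ π → av π ∧ (occ (suc k) π ≡ᵇ 1)) (S n))
  (∑-cong (λ π → cong (λ b → ⟦ av π ∧ b ⟧) (weight (occ (suc k) π) _ (occ-one⇒suc-zero k π))) (S n))
  where
  weight : ∀ m l → (m ≡ 1 → l ≡ 0) → (m ≡ᵇ 1) ≡ (m ≡ᵇ 1) ∧ (l ≡ᵇ 0)
  weight zero          l m⇒l = refl
  weight (suc zero)    l m⇒l rewrite m⇒l refl = refl
  weight (suc (suc _)) l m⇒l = refl

-- Since `V k` is x^(k/2) U_k(1/(2√x)), the formula G = 1/U_k² becomes G · (V k)² = x^k, read
-- coefficientwise.
theorem3p7 : (k : ℕ) → 3 ≤ k → (n : ℕ) →
    convCoeff (λ m → + g (p21-3-k k) m) (V k ⊗ V k) n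
    ≡ (if n ≡ᵇ k then + 1 else + 0)
theorem3p7 (suc (suc (suc k))) (s≤s (s≤s (s≤s z≤n))) n = begin
  convCoeff (λ m → + g (τ (suc k)) m) (V (3 + k) ⊗ V (3 + k)) n
    ≡⟨ convCoeff-⊛ _ (V (3 + k) ⊗ V (3 + k)) n ⟩
  ((λ m → + g (τ (suc k)) m) ⊛ coeff (V (3 + k) ⊗ V (3 + k))) n
    ≡⟨ ⊛-cong (λ m → cong +_ (g-once k m)) (coeff-⊗ (V (3 + k)) (V (3 + k))) n ⟩
  (H (suc k) ⊛ (v (3 + k) ⊛ v (3 + k))) n
    ≡⟨ H⊛v² (suc k) n ⟩
  X^ (3 + k) n
    ≡⟨ X^-coeff (3 + k) n ⟩
  (if n ≡ᵇ 3 + k then + 1 else + 0) ∎
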